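{- Let $n$ be odd and let $B_n$ be the set of $n\times n$ $(0,1)$-matrices. For $A\in B_n$ let $\sigma_0(A)$ be the number of zero entries of $A$. Then \[ AT(n)=\frac{(-1)^{\frac{n(n-1)}{2}}}{n!\,(n-1)!}\sum_{A\in B_n}(-1)^{\sigma_0(A)}\,\mathrm{per}(A)\det(A)^{n-1}. \]
   Context: $\mathrm{per}$ denotes the permanent. A Latin square of order $n$ is an $n\times n$ array with entries in $[n]$ in which each number appears exactly once in each row and each column. Viewing rows and columns as permutations of $[n]$, the sign of a Latin square is the product of the signs of all its rows and all its columns; it is even if its sign is $1$ and odd if $-1$. A Latin square is normalized if its first row is the identity permutation and unipotent if all entries on its main diagonal are equal. $AT(n)=U_n^{\mathrm{E}}-U_n^{\mathrm{O}}$, where $U_n^{\mathrm{E}}$ ($U_n^{\mathrm{O}}$) is the number of normalized unipotent even (odd) Latin squares of order $n$. -}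

module Defs where

open import Data.Bool using (Bool; true; false; _∧_; if_then_else_; not; T?)
open import Data.Bool.ListAction using (and)
open import Data.Nat as ℕ using (ℕ; zero; suc; _<ᵇ_; _∸_)
open import Data.Fin using (Fin; toℕ)
open import Data.Fin.Properties using (_≟_)
open import Data.List as List using (List; []; _∷_; map; concatMap; filter; length; allFin; foldr)
open import Data.Integer as ℤ using (ℤ; +_; -_)
open import Relation.Nullary.Decidable using (⌊_⌋)

allFuns : {A : Set} → (m : ℕ) → List A → List (Fin m → A)
allFuns zero    xs = (λ ()) ∷ []
allFuns (suc m) xs =
  concatMap (λ x → map (λ f → λ { Fin.zero → x ; (Fin.suc i) → f i }) (allFuns m xs)) xs

sumℤ : {A : Set} → List A → (A → ℤ) → ℤ
sumℤ xs f = foldr (λ x acc → f x ℤ.+ acc) (+ 0) xs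

prodℤ : {A : Set} → List A → (A → ℤ) → ℤ
prodℤ xs f = foldr (λ x acc → f x ℤ.* acc) (+ 1) xs

sumℕ : {A : Set} → List A → (A → ℕ) → ℕ
sumℕ xs f = foldr (λ x acc → f x ℕ.+ acc) 0 xs

countB : {A : Set} → List A → (A → Bool) → ℕ
countB xs p = length (filter (λ x → T? (p x)) xs)

allB : {A : Set} → List A → (A → Bool) → Bool
allB xs p = and (map p xs)

neg1^ : ℕ → ℤ
neg1^ zero    = + 1
neg1^ (suc k) = - neg1^ k

isPerm : {n : ℕ} → (Fin n → Fin n) → Bool
isPerm {n} f = allB (allFin n) λ i → allB (allFin n) λ j →
  if toℕ i <ᵇ toℕ j then not ⌊ f i ≟ f j ⌋ else true

perms : (n : ℕ) → List (Fin n → Fin n)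
perms n = filter (λ f → T? (isPerm f)) (allFuns n (allFin n))

inversions : {n : ℕ} → (Fin n → Fin n) → ℕ
inversions {n} f = sumℕ (allFin n) λ i →
  countB (allFin n) λ j → (toℕ i <ᵇ toℕ j) ∧ (toℕ (f j) <ᵇ toℕ (f i))

sgn : {n : ℕ} → (Fin n → Fin n) → ℤ
sgn f = neg1^ (inversions f)

Matrix : ℕ → Set
Matrix n = Fin n → Fin n → ℤ

per : {n : ℕ} → Matrix n → ℤ
per {n} A = sumℤ (perms n) λ σ → prodℤ (allFin n) λ i → A i (σ i)

det : {n : ℕ} → Matrix n → ℤ
det {n} A = sumℤ (perms n) λ σ → sgn σ ℤ.* (prodℤ (allFin n) λ i → A i (σ i))

BoolMatrix : ℕ → Set
BoolMatrix n = Fin n → Fin n → Bool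

Bmats : (n : ℕ) → List (BoolMatrix n)
Bmats n = allFuns n (allFuns n (false ∷ true ∷ []))

toℤMatrix : {n : ℕ} → BoolMatrix n → Matrix n
toℤMatrix A i j = if A i j then + 1 else + 0

σ₀ : {n : ℕ} → BoolMatrix n → ℕ
σ₀ {n} A = sumℕ (allFin n) λ i → countB (allFin n) λ j → not (A i j)

Square : ℕ → Set
Square n = Fin n → Fin n → Fin n

row : {n : ℕ} → Square n → Fin n → (Fin n → Fin n)
row L i = λ j → L i j

col : {n : ℕ} → Square n → Fin n → (Fin n → Fin n)
col L j = λ i → L i j

isLatin : {n : ℕ} → Square n → Bool
isLatin {n} L = allB (allFin n) (λ i → isPerm (row L i)) ∧ allB (allFin n) (λ j → isPerm (col L j))

isNormalized : {n : ℕ} → Square n → Bool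
isNormalized {n} L = allB (allFin n) λ i → allB (allFin n) λ j →
  if toℕ i ℕ.≡ᵇ 0 then ⌊ L i j ≟ j ⌋ else true

isUnipotent : {n : ℕ} → Square n → Bool
isUnipotent {n} L = allB (allFin n) λ i → allB (allFin n) λ j → ⌊ L i i ≟ L j j ⌋

sgnLS : {n : ℕ} → Square n → ℤ
sgnLS {n} L = (prodℤ (allFin n) λ i → sgn (row L i)) ℤ.* (prodℤ (allFin n) λ j → sgn (col L j))

NULS : (n : ℕ) → List (Square n)
NULS n = filter (λ L → T? (isLatin L ∧ isNormalized L ∧ isUnipotent L))
                (allFuns n (allFuns n (allFin n)))

isEven? : {n : ℕ} → Square n → Bool
isEven? L = ⌊ sgnLS L ℤ.≟ + 1 ⌋

U-E : ℕ → ℕ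
U-E n = countB (NULS n) isEven?

U-O : ℕ → ℕ
U-O n = countB (NULS n) (λ L → not (isEven? L))

AT : ℕ → ℤ
AT n = + U-E n ℤ.- + U-O n

{-# OPTIONS --safe #-}
-- Write per(A) det(A)^(n-1) as a sum over n-tuples of permutations. The alternating sum over A keeps
-- exactly the tuples whose graphs cover every cell, i.e. the Latin squares, each weighted by the signs
-- of all rows but the first. As n - 1 is even, permuting columns preserves this weight, and so does
-- permuting the other rows; normalising the first row and column gives n! (n-1)! times the sum of the
-- row signs of the reduced Latin squares. Exchanging the roles of rows, columns and symbols maps normalized
-- unipotent squares to reduced ones, and the product of the row, column and symbol signs of
-- any Latin square is (-1)^(n(n-1)/2).
module Submission where

open import Defs
open import Algebra.Bundles using (AbelianGroup)
import Algebra.Properties.CommutativeMonoid.Sum as CMSum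
open import Algebra.Properties.Group using (∙-cancelʳ)
open import Data.Bool using (Bool; true; false; _∧_; if_then_else_; not; T; T?)
open import Data.Bool.ListAction using (and)
open import Data.Bool.Properties using (T-∧)
open import Data.Empty using (⊥-elim)
open import Data.Fin using (Fin; zero; suc; toℕ; punchOut)
open import Data.Fin.Permutation using (Permutation; permutation; _⟨$⟩ʳ_)
open import Data.Fin.Properties using (_≟_; any?; all?; punchOut-injective; <⇒notInjective; ¬∀⟶∃¬; suc-injective)
open import Data.Integer as ℤ using (ℤ; +_; -_; _*_; _^_; _+_; _-_; ∣_∣; -[1+_])
open import Data.Integer.Properties using (*-1-commutativeMonoid; +-identityʳ; +-identityˡ; *-identityˡ; *-identityʳ; *-zeroˡ; *-zeroʳ; *-assoc; *-comm; *-distribˡ-+; +-assoc; neg-distribˡ-*; ^-*-assoc; ^-zeroˡ; abs-*; pos-*; +-0-abelianGroup; -1*i≡-i)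
open import Data.Integer.Tactic.RingSolver using (solve-∀)
open import Data.List using (List; []; _∷_; _++_; map; concatMap; filter; length; allFin; tabulate)
open import Data.Nat using (_!; _∸_; _/_)
open import Data.Nat as ℕ using (ℕ; zero; suc; _<ᵇ_)
open import Data.Nat.DivMod using (m*n/n≡m)
import Data.Nat.Properties as ℕ
import Data.Nat.Tactic.RingSolver as ℕRing
open import Data.Product as Product using (∃; _×_; _,_; proj₁; proj₂)
open import Data.Sum using (_⊎_; inj₁; inj₂)
open import Data.Unit using (tt)
open import Function using (_∘_; id; case_of_)
open import Function.Bundles using (Equivalence)
open import Function.Definitions using (Injective)
open import Relation.Binary.PropositionalEquality using (_≡_; _≢_; _≗_; refl; sym; trans; cong; cong₂; module ≡-Reasoning)
open import Relation.Nullary using (¬_; Dec; yes; no; contradiction)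
open import Relation.Nullary.Decidable using (⌊_⌋; toWitness; fromWitness)

-- Two obstacles shape the argument. Signs of rows, columns and symbols live on different index
-- sets. Each is therefore expanded into a product of signs over ordered pairs of indices, so that
-- an identity between signs becomes a reindexing of finite products followed by a case check on
-- order relations. The common yardstick is `crossings`, a product over pairs of rows and pairs of a
-- second coordinate. Rows and columns of a Latin square are bijections, so that coordinate may be
-- read as a column or as a symbol without changing the value. Its exponent is t * t with t =
-- n(n-1)/2, which has the parity of t; this is where the sign in the theorem comes from. Matrices
-- and squares are functions drawn from lists and can be compared only pointwise. Bijections and
-- counts are therefore expressed by sums of indicators over a decidable relation, and the basic
-- move is to insert a sum of indicators equal to 1 and exchange two sums.

private variable
  A B : Set
  m n : ℕ

ι : Bool → ℤ
ι b = if b then + 1 else + 0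

sign : Bool → ℤ
sign b = if b then - (+ 1) else + 1

-- The multiplicative counterpart of `ι`: a factor that becomes 1 when the condition fails. A
-- product over constrained pairs can thus be written over all pairs, where it can be split and
-- reindexed.
guard : Bool → ℤ → ℤ
guard b x = if b then x else + 1

-- Products over Fin

*-interchange : ∀ a b c d → (a * b) * (c * d) ≡ (a * c) * (b * d)
*-interchange = solve-∀

opaque
  ∏ : (Fin n → ℤ) → ℤ
  ∏ {zero} f = + 1
  ∏ {suc n} f = f zero * ∏ (f ∘ suc)

  ∏-[] : (f : Fin 0 → ℤ) → ∏ f ≡ + 1
  ∏-[] f = refl

  ∏-∷ : (f : Fin (suc n) → ℤ) → ∏ f ≡ f zero * ∏ (λ i → f (suc i))
  ∏-∷ f = refl

∏-cong : {f g : Fin n → ℤ} → f ≗ g → ∏ f ≡ ∏ g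
∏-cong {zero} e = trans (∏-[] _) (sym (∏-[] _))
∏-cong {suc n} e = trans (∏-∷ _) (trans (cong₂ _*_ (e zero) (∏-cong (e ∘ suc))) (sym (∏-∷ _)))

∏-distrib-* : (f g : Fin n → ℤ) → ∏ (λ i → f i * g i) ≡ ∏ f * ∏ g
∏-distrib-* {zero} f g = trans (∏-[] _) (sym (cong₂ _*_ (∏-[] f) (∏-[] g)))
∏-distrib-* {suc n} f g = begin
  ∏ (λ i → f i * g i)
    ≡⟨ ∏-∷ _ ⟩
  f zero * g zero * ∏ (λ i → f (suc i) * g (suc i))
    ≡⟨ cong (f zero * g zero *_) (∏-distrib-* (f ∘ suc) (g ∘ suc)) ⟩
  f zero * g zero * (∏ (f ∘ suc) * ∏ (g ∘ suc))
    ≡⟨ *-interchange (f zero) (g zero) _ _ ⟩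
  f zero * ∏ (f ∘ suc) * (g zero * ∏ (g ∘ suc))
    ≡⟨ cong₂ _*_ (∏-∷ f) (∏-∷ g) ⟨
  ∏ f * ∏ g ∎
  where open ≡-Reasoning

∏-one : ∀ n → ∏ {n} (λ _ → + 1) ≡ + 1
∏-one zero = ∏-[] _
∏-one (suc n) = trans (∏-∷ _) (trans (*-identityˡ _) (∏-one n))

∏-comm : (f : Fin m → Fin n → ℤ) → ∏ (λ i → ∏ λ j → f i j) ≡ ∏ (λ j → ∏ λ i → f i j)
∏-comm {zero} {n} f = trans (∏-[] _) (sym (trans (∏-cong λ j → ∏-[] _) (∏-one n)))
∏-comm {suc m} f = begin
  ∏ (λ i → ∏ λ j → f i j)                 ≡⟨ ∏-∷ _ ⟩
  ∏ (f zero) * ∏ (λ i → ∏ (f (suc i)))    ≡⟨ cong (∏ (f zero) *_) (∏-comm (f ∘ suc)) ⟩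
  ∏ (f zero) * ∏ (λ j → ∏ λ i → f (suc i) j) ≡⟨ ∏-distrib-* (f zero) _ ⟨
  ∏ (λ j → f zero j * ∏ (λ i → f (suc i) j)) ≡⟨ ∏-cong (λ j → ∏-∷ (λ i → f i j)) ⟨
  ∏ (λ j → ∏ λ i → f i j) ∎
  where open ≡-Reasoning

∏-permute : (f : Fin n → ℤ) (π : Permutation n n) → ∏ f ≡ ∏ (λ i → f (π ⟨$⟩ʳ i))
∏-permute f π = trans (∏≡sum f) (trans (sum-permute f π) (sym (∏≡sum λ i → f (π ⟨$⟩ʳ i))))
  where
  open CMSum *-1-commutativeMonoid using (sum; sum-permute)
  ∏≡sum : ∀ {n} (f : Fin n → ℤ) → ∏ f ≡ sum f
  ∏≡sum {zero} f = ∏-[] f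
  ∏≡sum {suc n} f = trans (∏-∷ f) (cong (f zero *_) (∏≡sum (f ∘ suc)))

prodℤ-tabulate : (g : Fin n → A) (f : A → ℤ) → prodℤ (tabulate g) f ≡ ∏ (f ∘ g)
prodℤ-tabulate {zero} g f = sym (∏-[] _)
prodℤ-tabulate {suc n} g f = trans (cong (f (g zero) *_) (prodℤ-tabulate (g ∘ suc) f)) (sym (∏-∷ _))

prodℤ-allFin : (f : Fin n → ℤ) → prodℤ (allFin n) f ≡ ∏ f
prodℤ-allFin = prodℤ-tabulate id

∏-cong₂ : {f g : Fin m → Fin n → ℤ} → (∀ i j → f i j ≡ g i j) →
  ∏ (λ i → ∏ (f i)) ≡ ∏ (λ i → ∏ (g i))
∏-cong₂ e = ∏-cong (λ i → ∏-cong (e i))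

∏-distrib-*₂ : (f g : Fin m → Fin n → ℤ) →
  ∏ (λ i → ∏ (λ j → f i j * g i j)) ≡ ∏ (λ i → ∏ (f i)) * ∏ (λ i → ∏ (g i))
∏-distrib-*₂ f g = trans (∏-cong λ i → ∏-distrib-* (f i) (g i)) (∏-distrib-* _ _)

∏-ones : (f : Fin n → ℤ) → (∀ i → f i ≡ + 1) → ∏ f ≡ + 1
∏-ones {n} f e = trans (∏-cong e) (∏-one n)

∏-zero : (f : Fin n → ℤ) (i : Fin n) → f i ≡ + 0 → ∏ f ≡ + 0
∏-zero f zero e = trans (∏-∷ f) (trans (cong (_* ∏ (f ∘ suc)) e) (*-zeroˡ (∏ (f ∘ suc))))
∏-zero f (suc i) e = trans (∏-∷ f) (trans (cong (f zero *_) (∏-zero (f ∘ suc) i e)) (*-zeroʳ (f zero)))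

∏-const : ∀ m x → ∏ {m} (λ _ → x) ≡ x ^ m
∏-const zero x = ∏-[] _
∏-const (suc m) x = trans (∏-∷ _) (cong (x *_) (∏-const m x))

⌊suc≟suc⌋ : (i j : Fin n) → ⌊ suc i ≟ suc j ⌋ ≡ ⌊ i ≟ j ⌋
⌊suc≟suc⌋ i j with i ≟ j
... | yes _ = refl
... | no _ = refl

∏-guard-≟ : (i : Fin n) (f : Fin n → ℤ) → ∏ (λ j → guard ⌊ i ≟ j ⌋ (f j)) ≡ f i
∏-guard-≟ zero f = trans (∏-∷ _) (trans (cong (f zero *_) (∏-ones _ λ _ → refl)) (*-identityʳ (f zero)))
∏-guard-≟ (suc i) f = trans (∏-∷ _) (trans (*-identityˡ _)
  (trans (∏-cong λ j → cong (λ b → guard b (f (suc j))) (⌊suc≟suc⌋ i j)) (∏-guard-≟ i (f ∘ suc))))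

∏-guard : (b : Bool) (f : Fin n → ℤ) → ∏ (λ j → guard b (f j)) ≡ guard b (∏ f)
∏-guard true f = refl
∏-guard {n} false f = ∏-one n

-- Comparisons in Fin

lt : Fin n → Fin n → Bool
lt i j = toℕ i <ᵇ toℕ j

-- Trichotomy, indexed by the Boolean tests themselves: matching on `cmp i j` inside a helper
-- generalised over the three Booleans evaluates all of them at once.
data Cmp {n} (i j : Fin n) : Bool → Bool → Bool → Set where
  less : i ≢ j → Cmp i j true false false
  same : i ≡ j → Cmp i j false true false
  more : i ≢ j → Cmp i j false false true

cmp : (i j : Fin n) → Cmp i j (lt i j) ⌊ i ≟ j ⌋ (lt j i)
cmp zero zero = same refl
cmp zero (suc j) = less λ ()
cmp (suc i) zero = more λ ()
cmp (suc i) (suc j) rewrite ⌊suc≟suc⌋ i j = up (cmp i j)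
  where
  up : ∀ {a b c} → Cmp i j a b c → Cmp (suc i) (suc j) a b c
  up (less p) = less (λ { refl → p refl })
  up (same p) = same (cong suc p)
  up (more p) = more (λ { refl → p refl })

-- By trichotomy each factor lies on, above or below the diagonal; the part below is transposed by
-- `∏-comm` and merged with the part above.
∏-triangle : (F : Fin n → Fin n → ℤ) →
  ∏ (λ i → ∏ (F i)) ≡ ∏ (λ i → F i i) * ∏ (λ i → ∏ λ j → guard (lt i j) (F i j * F j i))
∏-triangle F = begin
  ∏ (λ i → ∏ (F i))
    ≡⟨ ∏-cong₂ (λ i j → split (cmp i j) (F i j)) ⟩
  ∏ (λ i → ∏ λ j → E i j * (U i j * V i j))
    ≡⟨ trans (∏-distrib-*₂ E _) (cong (∏ (λ i → ∏ (E i)) *_) (∏-distrib-*₂ U V)) ⟩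
  ∏ (λ i → ∏ (E i)) * (∏ (λ i → ∏ (U i)) * ∏ (λ i → ∏ (V i)))
    ≡⟨ cong₂ (λ x y → x * (∏ (λ i → ∏ (U i)) * y)) (∏-cong λ i → ∏-guard-≟ i (F i)) (∏-comm V) ⟩
  ∏ (λ i → F i i) * (∏ (λ i → ∏ (U i)) * ∏ (λ i → ∏ λ j → V j i))
    ≡⟨ cong (∏ (λ i → F i i) *_) (sym (∏-distrib-*₂ U λ i j → V j i)) ⟩
  ∏ (λ i → F i i) * ∏ (λ i → ∏ λ j → U i j * V j i)
    ≡⟨ cong (∏ (λ i → F i i) *_) (∏-cong₂ λ i j → join (lt i j) (F i j) (F j i)) ⟩
  ∏ (λ i → F i i) * ∏ (λ i → ∏ λ j → guard (lt i j) (F i j * F j i)) ∎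
  where
  open ≡-Reasoning
  E = λ i j → guard ⌊ i ≟ j ⌋ (F i j)
  U = λ i j → guard (lt i j) (F i j)
  V = λ i j → guard (lt j i) (F i j)
  split : ∀ {i j : Fin n} {a b c} → Cmp i j a b c → ∀ x → x ≡ guard b x * (guard a x * guard c x)
  split (less _) x = sym (trans (*-identityˡ _) (*-identityʳ x))
  split (same _) x = sym (*-identityʳ x)
  split (more _) x = sym (trans (*-identityˡ _) (*-identityˡ x))
  join : ∀ b x y → guard b x * guard b y ≡ guard b (x * y)
  join true x y = refl
  join false x y = refl

-- Injective self-maps of Fin

Inj : {A : Set} → (A → Fin n) → Set
Inj f = Injective _≡_ _≡_ f

-- Pigeonhole: if `y` were missed, deleting it from the codomain by `punchOut` would give an
-- injection into a smaller `Fin`.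
inj⇒surj : (f : Fin n → Fin n) → Inj f → ∀ y → ∃ λ x → f x ≡ y
inj⇒surj {suc n} f inj y with any? (λ x → f x ≟ y)
... | yes p = p
... | no ¬p = contradiction
        (λ {x} {x′} e → inj (punchOut-injective (y≢f x) (y≢f x′) e))
        (<⇒notInjective {f = λ x → punchOut (y≢f x)} (ℕ.n<1+n n))
  where
  y≢f : ∀ x → y ≢ f x
  y≢f x e = ¬p (x , sym e)

-- A choice of preimages `g` is a section of `f`, hence injective, hence surjective. Both arguments
-- then lie in the image of `g`, where `f` can be undone.
surj⇒inj : (f : Fin n → Fin n) → (∀ y → ∃ λ x → f x ≡ y) → Inj f
surj⇒inj f surj {x} {x′} e = trans (sym (proj₂ p)) (trans (cong g y≡y′) (proj₂ p′))
  where
  g = λ y → proj₁ (surj y)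
  fg = λ y → proj₂ (surj y)
  g-inj : Inj g
  g-inj {y} {y′} q = trans (sym (fg y)) (trans (cong f q) (fg y′))
  p = inj⇒surj g g-inj x
  p′ = inj⇒surj g g-inj x′
  y≡y′ : proj₁ p ≡ proj₁ p′
  y≡y′ = trans (trans (sym (fg _)) (cong f (proj₂ p))) (trans e (sym (trans (sym (fg _)) (cong f (proj₂ p′)))))

-- junk value y when y has no preimage
inv : (Fin n → Fin n) → Fin n → Fin n
inv f y with any? (λ x → f x ≟ y)
... | yes (x , _) = x
... | no _ = y

inv-right : (f : Fin n → Fin n) → Inj f → ∀ y → f (inv f y) ≡ y
inv-right f inj y with any? (λ x → f x ≟ y)
... | yes (x , e) = e
... | no ¬p = contradiction (inj⇒surj f inj y) ¬p

inv-left : (f : Fin n → Fin n) → Inj f → ∀ x → inv f (f x) ≡ x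
inv-left f inj x = inj (inv-right f inj (f x))

∏-reindex : (f : Fin n → Fin n) → Inj f → (g : Fin n → ℤ) → ∏ (g ∘ f) ≡ ∏ g
∏-reindex f inj g = sym (∏-permute g (permutation f (inv f) (inv-right f inj) (inv-left f inj)))

-- Boolean reflection

ι-∧ : ∀ a b → ι (a ∧ b) ≡ ι a * ι b
ι-∧ true b = sym (*-identityˡ _)
ι-∧ false b = sym (*-zeroˡ (ι b))

allB-tabulate : (p : A → Bool) (g : Fin n → A) → ι (and (map p (tabulate g))) ≡ ∏ (λ i → ι (p (g i)))
allB-tabulate {n = zero} p g = sym (∏-[] _)
allB-tabulate {n = suc n} p g = trans (ι-∧ (p (g zero)) _)
  (trans (cong (ι (p (g zero)) *_) (allB-tabulate p (g ∘ suc))) (sym (∏-∷ _)))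

ι-allB : (p : Fin n → Bool) → ι (allB (allFin n) p) ≡ ∏ (ι ∘ p)
ι-allB p = allB-tabulate p id

and⁻ : (p : A → Bool) (g : Fin n → A) → T (and (map p (tabulate g))) → ∀ i → T (p (g i))
and⁻ {n = suc n} p g t i with p (g zero) in eq
and⁻ {n = suc n} p g t zero | true rewrite eq = tt
and⁻ {n = suc n} p g t (suc i) | true = and⁻ p (g ∘ suc) t i

and⁺ : (p : A → Bool) (g : Fin n → A) → (∀ i → T (p (g i))) → T (and (map p (tabulate g)))
and⁺ {n = zero} p g h = tt
and⁺ {n = suc n} p g h with p (g zero) | h zero
... | true | _ = and⁺ p (g ∘ suc) (h ∘ suc)

allB⁻ : {p : Fin n → Bool} → T (allB (allFin n) p) → ∀ i → T (p i)
allB⁻ {p = p} = and⁻ p id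

allB⁺ : {p : Fin n → Bool} → (∀ i → T (p i)) → T (allB (allFin n) p)
allB⁺ {p = p} = and⁺ p id

∧⁻ : ∀ {a b} → T (a ∧ b) → T a × T b
∧⁻ = Equivalence.to T-∧

∧⁺ : ∀ {a b} → T a → T b → T (a ∧ b)
∧⁺ p q = Equivalence.from T-∧ (p , q)

ι-⇔ : ∀ {a b} → (T a → T b) → (T b → T a) → ι a ≡ ι b
ι-⇔ {true} {true} f g = refl
ι-⇔ {true} {false} f g = ⊥-elim (f tt)
ι-⇔ {false} {true} f g = ⊥-elim (g tt)
ι-⇔ {false} {false} f g = refl

ι-elim : ∀ b {x y} → (T b → x ≡ y) → (¬ T b → x ≡ + 0) → x ≡ ι b * y
ι-elim true {x} {y} f g = trans (f tt) (sym (*-identityˡ y))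
ι-elim false {x} {y} f g = trans (g (λ ())) (sym (*-zeroˡ y))

ι-* : ∀ b {x y} → (T b → x ≡ y) → ι b * x ≡ ι b * y
ι-* true f = cong (+ 1 *_) (f tt)
ι-* false {x} {y} f = trans (*-zeroˡ x) (sym (*-zeroˡ y))

not-≟⁻ : {x y : Fin n} → T (not ⌊ x ≟ y ⌋) → x ≢ y
not-≟⁻ {x = x} {y} t with x ≟ y
... | no ¬p = ¬p

not-≟⁺ : {x y : Fin n} → x ≢ y → T (not ⌊ x ≟ y ⌋)
not-≟⁺ {x = x} {y} x≢y with x ≟ y
... | yes p = x≢y p
... | no _ = tt

isPerm⇒inj : {f : Fin n → Fin n} → T (isPerm f) → Inj f
isPerm⇒inj {f = f} t {i} {j} e = decide (cmp i j) (allB⁻ (allB⁻ t i) j) (allB⁻ (allB⁻ t j) i)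
  where
  decide : ∀ {a b c} → Cmp i j a b c →
    T (if a then not ⌊ f i ≟ f j ⌋ else true) → T (if c then not ⌊ f j ≟ f i ⌋ else true) → i ≡ j
  decide (less _) t₁ t₂ = contradiction e (not-≟⁻ t₁)
  decide (same p) t₁ t₂ = p
  decide (more _) t₁ t₂ = contradiction (sym e) (not-≟⁻ t₂)

inj⇒isPerm : {f : Fin n → Fin n} → Inj f → T (isPerm f)
inj⇒isPerm {f = f} inj = allB⁺ λ i → allB⁺ λ j → decide (cmp i j)
  where
  decide : ∀ {i j a b c} → Cmp i j a b c → T (if a then not ⌊ f i ≟ f j ⌋ else true)
  decide (less p) = not-≟⁺ (p ∘ inj)
  decide (same _) = tt
  decide (more _) = tt

-- Signs of permutations

sign-*-self : ∀ b → sign b * sign b ≡ + 1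
sign-*-self true = refl
sign-*-self false = refl

neg1^-+ : ∀ a b → neg1^ (a ℕ.+ b) ≡ neg1^ a * neg1^ b
neg1^-+ zero b = sym (*-identityˡ (neg1^ b))
neg1^-+ (suc a) b = trans (cong -_ (neg1^-+ a b)) (neg-distribˡ-* (neg1^ a) (neg1^ b))

neg1^-sumℕ : (f : Fin n → ℕ) → neg1^ (sumℕ (allFin n) f) ≡ ∏ (neg1^ ∘ f)
neg1^-sumℕ {n} f = go id
  where
  go : ∀ {m} (g : Fin m → Fin n) → neg1^ (sumℕ (tabulate g) f) ≡ ∏ (λ i → neg1^ (f (g i)))
  go {zero} g = sym (∏-[] _)
  go {suc m} g = trans (neg1^-+ (f (g zero)) _)
    (trans (cong (neg1^ (f (g zero)) *_) (go (g ∘ suc))) (sym (∏-∷ _)))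

neg1^-countB : (p : Fin n → Bool) → neg1^ (countB (allFin n) p) ≡ ∏ (sign ∘ p)
neg1^-countB {n} p = go id
  where
  step : ∀ x xs → neg1^ (countB (x ∷ xs) p) ≡ sign (p x) * neg1^ (countB xs p)
  step x xs with p x
  ... | true = neg≡-1* _
    where
    neg≡-1* : ∀ i → - i ≡ - (+ 1) * i
    neg≡-1* = solve-∀
  ... | false = sym (*-identityˡ _)
  go : ∀ {m} (g : Fin m → Fin n) → neg1^ (countB (tabulate g) p) ≡ ∏ (λ i → sign (p (g i)))
  go {zero} g = sym (∏-[] _)
  go {suc m} g = trans (step (g zero) (tabulate (g ∘ suc)))
    (trans (cong (sign (p (g zero)) *_) (go (g ∘ suc))) (sym (∏-∷ _)))

neg1^-∏∏ : (p : Fin n → Fin n → Bool) →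
  neg1^ (sumℕ (allFin n) λ i → countB (allFin n) (p i)) ≡ ∏ λ i → ∏ λ j → sign (p i j)
neg1^-∏∏ p = trans (neg1^-sumℕ _) (∏-cong λ i → neg1^-countB (p i))

inversion : Fin m → Fin m → Fin n → Fin n → ℤ
inversion i j u v = sign (lt i j ∧ lt v u)

sgn-∏ : (f : Fin n → Fin n) → sgn f ≡ ∏ λ i → ∏ λ j → inversion i j (f i) (f j)
sgn-∏ f = neg1^-∏∏ λ i j → lt i j ∧ lt (f j) (f i)

sgn-cong : {f g : Fin n → Fin n} → f ≗ g → sgn f ≡ sgn g
sgn-cong {f = f} {g} e = trans (sgn-∏ f)
  (trans (∏-cong₂ λ i j → cong₂ (inversion i j) (e i) (e j)) (sym (sgn-∏ g)))

inversion-square : (i j : Fin m) (u v : Fin n) → inversion i j u v * inversion i j u v ≡ + 1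
inversion-square i j u v = sign-*-self (lt i j ∧ lt v u)

inversion-guard : (i j : Fin m) (u v : Fin n) → inversion i j u v ≡ guard (lt i j) (sign (lt v u))
inversion-guard i j u v with lt i j
... | true = refl
... | false = refl

guard-* : ∀ b x y → guard b (x * y) ≡ guard b x * guard b y
guard-* true x y = refl
guard-* false x y = refl

guard-one : ∀ b → guard b (+ 1) ≡ + 1
guard-one true = refl
guard-one false = refl

guard-cong : ∀ b {x y} → (T b → x ≡ y) → guard b x ≡ guard b y
guard-cong true f = f tt
guard-cong false f = refl

sgn-square : (f : Fin n → Fin n) → sgn f * sgn f ≡ + 1
sgn-square f = trans (cong₂ _*_ (sgn-∏ f) (sgn-∏ f)) (trans (sym (∏-distrib-*₂ F F))
  (∏-ones _ λ i → ∏-ones _ λ j → inversion-square i j (f i) (f j)))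
  where F = λ i j → inversion i j (f i) (f j)

sgn-id : sgn {n} id ≡ + 1
sgn-id {n} = trans (sgn-∏ {n} id) (∏-ones _ λ i → ∏-ones _ λ j → go (cmp i j))
  where
  go : ∀ {i j : Fin n} {a b c} → Cmp i j a b c → sign (a ∧ c) ≡ + 1
  go (less _) = refl
  go (same _) = refl
  go (more _) = refl

-- The factors of sgn σ at (τ i, τ j) and (τ j, τ i) with i < j multiply to the
-- sign of the pair {τ i, τ j} under σ, whichever of τ i and τ j is smaller.
sgn-∘ : (σ τ : Fin n → Fin n) → Inj σ → Inj τ → sgn (σ ∘ τ) ≡ sgn σ * sgn τ
sgn-∘ {n} σ τ σ-inj τ-inj = begin
  sgn (σ ∘ τ)
    ≡⟨ sgn-∏ (σ ∘ τ) ⟩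
  ∏ (λ i → ∏ λ j → inversion i j (σ (τ i)) (σ (τ j)))
    ≡⟨ ∏-cong₂ pointwise ⟩
  ∏ (λ i → ∏ λ j → H i j * inversion i j (τ i) (τ j))
    ≡⟨ trans (∏-distrib-*₂ H _) (cong (∏ (λ i → ∏ (H i)) *_) (sym (sgn-∏ τ))) ⟩
  ∏ (λ i → ∏ (H i)) * sgn τ
    -- `∏-triangle` backwards: the product of `H` over i < j becomes a product over all ordered
    -- pairs, in which `τ` merely permutes the factors.
    ≡⟨ cong (_* sgn τ) (sym (trans (∏-triangle (λ i j → D (τ i) (τ j)))
         (trans (cong (_* ∏ (λ i → ∏ (H i))) (∏-ones _ (λ i → diag (cmp (τ i) (τ i))))) (*-identityˡ _)))) ⟩
  ∏ (λ i → ∏ λ j → D (τ i) (τ j)) * sgn τ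
    ≡⟨ cong (_* sgn τ) (trans (∏-cong λ i → ∏-reindex τ τ-inj (D (τ i))) (∏-reindex τ τ-inj λ i → ∏ (D i))) ⟩
  ∏ (λ i → ∏ λ j → D i j) * sgn τ
    ≡⟨ cong (_* sgn τ) (sym (sgn-∏ σ)) ⟩
  sgn σ * sgn τ ∎
  where
  open ≡-Reasoning
  D = λ i j → inversion i j (σ i) (σ j)
  H = λ i j → guard (lt i j) (D (τ i) (τ j) * D (τ j) (τ i))
  diag : ∀ {i : Fin n} {a b c d} → Cmp i i a b c → sign (a ∧ d) ≡ + 1
  diag (less p) = contradiction refl p
  diag (same _) = refl
  diag (more p) = contradiction refl p
  compare : ∀ {i j u v : Fin n} {a b c a′ b′ c′} → i ≢ j → u ≢ v → Cmp i j a b c → Cmp u v a′ b′ c′ →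
    sign c′ ≡ sign (a ∧ c′) * sign (c ∧ a′) * sign c
  compare p q (less _) (less _) = refl
  compare p q (less _) (same e) = contradiction e q
  compare p q (less _) (more _) = refl
  compare p q (same e) y = contradiction e p
  compare p q (more _) (less _) = refl
  compare p q (more _) (same e) = contradiction e q
  compare p q (more _) (more _) = refl
  lt⇒≢ : ∀ {i j : Fin n} {a b c} → Cmp i j a b c → T a → i ≢ j
  lt⇒≢ (less p) _ = p
  pointwise : ∀ i j → inversion i j (σ (τ i)) (σ (τ j)) ≡ H i j * inversion i j (τ i) (τ j)
  pointwise i j = begin
    inversion i j (σ (τ i)) (σ (τ j))
      ≡⟨ inversion-guard i j (σ (τ i)) (σ (τ j)) ⟩
    guard (lt i j) (sign (lt (σ (τ j)) (σ (τ i))))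
      ≡⟨ guard-cong (lt i j) (λ t → let i≢j = lt⇒≢ (cmp i j) t in
           compare (i≢j ∘ τ-inj) (i≢j ∘ τ-inj ∘ σ-inj) (cmp (τ i) (τ j)) (cmp (σ (τ i)) (σ (τ j)))) ⟩
    guard (lt i j) (D (τ i) (τ j) * D (τ j) (τ i) * sign (lt (τ j) (τ i)))
      ≡⟨ guard-* (lt i j) _ _ ⟩
    H i j * guard (lt i j) (sign (lt (τ j) (τ i)))
      ≡⟨ cong (H i j *_) (inversion-guard i j (τ i) (τ j)) ⟨
    H i j * inversion i j (τ i) (τ j) ∎

-- Sign of a Latin square and of its conjugate

record Latin (L : Square n) : Set where
  constructor latin
  field
    row-inj : ∀ r → Inj (row L r)
    col-inj : ∀ c → Inj (col L c)
open Latin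

-- For fixed r and r′, equal or not, the pair (L r c, L r′ c′) runs once through all pairs as (c,
-- c′) does.
∏∏-reindex : (L : Square n) → (∀ r → Inj (row L r)) → (F : Fin n → Fin n → Fin n → Fin n → ℤ) →
  ∏ (λ r → ∏ λ r′ → ∏ λ c → ∏ λ c′ → F r r′ (L r c) (L r′ c′)) ≡
  ∏ (λ r → ∏ λ r′ → ∏ λ c → ∏ λ c′ → F r r′ c c′)
∏∏-reindex L inj F = ∏-cong₂ λ r r′ →
  trans (∏-cong λ c → ∏-reindex (L r′) (inj r′) (F r r′ (L r c)))
        (∏-reindex (L r) (inj r) λ c → ∏ (F r r′ c))

-- One factor -1 for each choice of r < r′ and c′ < c, so (-1)^(t * t) with t = n(n-1)/2.
crossings : ℕ → ℤ
crossings n = ∏ {n} λ r → ∏ {n} λ r′ → ∏ {n} λ c → ∏ {n} λ c′ → inversion r r′ c c′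

∏-swap-pairs : (F : Fin n → Fin n → Fin n → Fin n → ℤ) →
  ∏ (λ a → ∏ λ b → ∏ λ c → ∏ λ d → F a b c d) ≡ ∏ (λ c → ∏ λ d → ∏ λ a → ∏ λ b → F a b c d)
∏-swap-pairs F = begin
  ∏ (λ a → ∏ λ b → ∏ λ c → ∏ λ d → F a b c d) ≡⟨ ∏-cong (λ a → ∏-comm λ b c → ∏ (F a b c)) ⟩
  ∏ (λ a → ∏ λ c → ∏ λ b → ∏ λ d → F a b c d) ≡⟨ ∏-comm (λ a c → ∏ λ b → ∏ λ d → F a b c d) ⟩
  ∏ (λ c → ∏ λ a → ∏ λ b → ∏ λ d → F a b c d) ≡⟨ ∏-cong₂ (λ c a → ∏-comm λ b d → F a b c d) ⟩
  ∏ (λ c → ∏ λ a → ∏ λ d → ∏ λ b → F a b c d) ≡⟨ ∏-cong (λ c → ∏-comm λ a d → ∏ λ b → F a b c d) ⟩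
  ∏ (λ c → ∏ λ d → ∏ λ a → ∏ λ b → F a b c d) ∎
  where open ≡-Reasoning

∏∏-guard : (r r′ : Fin n) (F : Fin n → Fin n → ℤ) →
  ∏ (λ c → ∏ λ c′ → guard (lt r r′) (F c c′)) ≡ guard (lt r r′) (∏ λ c → ∏ λ c′ → F c c′)
∏∏-guard r r′ F = trans (∏-cong λ c → ∏-guard (lt r r′) (F c)) (∏-guard (lt r r′) λ c → ∏ (F c))

-- `M s r` is the column in which row `r` of `L` holds the symbol `s`. Hence the rows of `M` are the
-- symbol permutations of `L`, and their signs are its symbol signs.
Conjugate : Square n → Square n → Set
Conjugate L M = ∀ r s → L r (M s r) ≡ s

±1 : ℤ → Set
±1 x = x * x ≡ + 1

±1-∏ : {f : Fin n → ℤ} → (∀ i → ±1 (f i)) → ±1 (∏ f)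
±1-∏ {f = f} h = trans (sym (∏-distrib-* f f)) (∏-ones _ h)

-- For every pair of rows r < r′ and every pair of columns c, c′ the six comparisons among
-- the columns and the symbols at (r , c) and (r′ , c′) cancel.
sgnLS-conjugate : {L M : Square n} → Latin L → Conjugate L M →
  sgnLS L ≡ crossings n * ∏ (λ s → sgn (row M s))
sgnLS-conjugate {n} {L} {M} lat conj = begin
  sgnLS L
    ≡⟨ cong₂ _*_ (prodℤ-allFin _) (prodℤ-allFin _) ⟩
  R * C
    ≡⟨ combine R C S Q W W≡RQ QCS≡1 C²≡1 ⟩
  W * S ∎
  where
  open ≡-Reasoning
  R = ∏ λ r → sgn (row L r)
  C = ∏ λ c → sgn (col L c)
  S = ∏ λ s → sgn (row M s)
  W = crossings n
  -- For r = r′ this is the sign of row r. The mixed terms r ≠ r′ are collected in `Q`.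
  F = λ r r′ → ∏ λ c → ∏ λ c′ → inversion c c′ (L r c) (L r′ c′)
  Q = ∏ λ r → ∏ λ r′ → guard (lt r r′) (F r r′ * F r′ r)

  combine : ∀ R C S Q W → W ≡ R * Q → Q * C * S ≡ + 1 → C * C ≡ + 1 → R * C ≡ W * S
  combine R C S Q W p q r = begin
    R * C                 ≡⟨ *-identityʳ _ ⟨
    R * C * + 1           ≡⟨ cong (R * C *_) q ⟨
    R * C * (Q * C * S)   ≡⟨ rearrange R C S Q ⟩
    R * Q * S * (C * C)   ≡⟨ cong₂ (λ x y → x * S * y) p (sym r) ⟨
    W * S * + 1           ≡⟨ *-identityʳ _ ⟩
    W * S ∎
    where
    rearrange : ∀ R C S Q → R * C * (Q * C * S) ≡ R * Q * S * (C * C)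
    rearrange = solve-∀

  C²≡1 : ±1 C
  C²≡1 = ±1-∏ λ c → sgn-square (col L c)

  W²≡1 : ±1 W
  W²≡1 = ±1-∏ λ r → ±1-∏ λ r′ → ±1-∏ λ c → ±1-∏ λ c′ → inversion-square r r′ c c′

  -- Grouped by pairs of columns, the symbols run over all pairs and the product is `W`; regrouped
  -- by pairs of rows, its diagonal part is `R` and the rest is `Q`.
  W≡RQ : W ≡ R * Q
  W≡RQ = begin
    W
      ≡⟨ ∏∏-reindex (λ c r → L r c) (col-inj lat) inversion ⟨
    ∏ (λ c → ∏ λ c′ → ∏ λ r → ∏ λ r′ → inversion c c′ (L r c) (L r′ c′))
      ≡⟨ ∏-swap-pairs (λ c c′ r r′ → inversion c c′ (L r c) (L r′ c′)) ⟩
    ∏ (λ r → ∏ λ r′ → F r r′)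
      ≡⟨ ∏-triangle F ⟩
    ∏ (λ r → F r r) * Q
      ≡⟨ cong (_* Q) (∏-cong λ r → sgn-∏ (row L r)) ⟨
    R * Q ∎

  below : ((r r′ : Fin n) → ℤ) → ℤ
  below G = ∏ λ r → ∏ λ r′ → guard (lt r r′) (G r r′)

  below-* : ∀ G H → below (λ r r′ → G r r′ * H r r′) ≡ below G * below H
  below-* G H = trans (∏-cong₂ λ r r′ → guard-* (lt r r′) _ _) (∏-distrib-*₂ _ _)

  signs : (f : Fin n → Fin n → Fin n) →
    ∏ (λ c → sgn (f c)) ≡ below λ r r′ → ∏ λ c → sign (lt (f c r′) (f c r))
  signs f = begin
    ∏ (λ c → sgn (f c))
      ≡⟨ ∏-cong (λ c → sgn-∏ (f c)) ⟩
    ∏ (λ c → ∏ λ r → ∏ λ r′ → inversion r r′ (f c r) (f c r′))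
      ≡⟨ trans (∏-comm _) (∏-cong λ r → ∏-comm _) ⟩
    ∏ (λ r → ∏ λ r′ → ∏ λ c → inversion r r′ (f c r) (f c r′))
      ≡⟨ ∏-cong₂ (λ r r′ → trans (∏-cong λ c → inversion-guard r r′ (f c r) (f c r′)) (∏-guard (lt r r′) _)) ⟩
    below (λ r r′ → ∏ λ c → sign (lt (f c r′) (f c r))) ∎

  crossings-below : (G : Fin n → Fin n → Fin n) →
    ∏ (λ r → ∏ λ r′ → ∏ λ c → ∏ λ c′ → inversion r r′ (G r c) (G r′ c′)) ≡
    below λ r r′ → ∏ λ c → ∏ λ c′ → sign (lt (G r′ c′) (G r c))
  crossings-below G = ∏-cong₂ λ r r′ →
    trans (∏-cong₂ λ c c′ → inversion-guard r r′ (G r c) (G r′ c′)) (∏∏-guard r r′ _)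

  -- Two readings of `W`, comparing symbols and comparing columns. As `W * W` is 1, both may be
  -- inserted next to `Q * C * S`; they supply the last two of the six factors in `cancel`.
  W₁ = below λ r r′ → ∏ λ c → ∏ λ c′ → sign (lt (L r′ c′) (L r c))
  W₂ = below λ r r′ → ∏ λ c → ∏ λ c′ → sign (lt c′ c)

  W≡W₁ : W ≡ W₁
  W≡W₁ = trans (sym (∏∏-reindex L (row-inj lat) inversion)) (crossings-below L)

  W≡W₂ : W ≡ W₂
  W≡W₂ = crossings-below (λ r c → c)

  columns : ∀ r r′ → ∏ (λ c → sign (lt (L r′ c) (L r c))) ≡
    ∏ λ c → ∏ λ c′ → guard ⌊ c ≟ c′ ⌋ (sign (lt (L r′ c′) (L r c)))
  columns r r′ = ∏-cong λ c → sym (∏-guard-≟ c λ c′ → sign (lt (L r′ c′) (L r c)))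

  -- A symbol s corresponds to the pair of cells (r, c), (r′, c′) that hold it. Doubling s into s =
  -- s′ lets s be reindexed along row r and s′ along row r′, which turns the product into one over
  -- pairs of columns.
  symbols : ∀ r r′ → ∏ (λ s → sign (lt (M s r′) (M s r))) ≡
    ∏ λ c → ∏ λ c′ → guard ⌊ L r c ≟ L r′ c′ ⌋ (sign (lt c′ c))
  symbols r r′ = begin
    ∏ (λ s → sign (lt (M s r′) (M s r)))
      ≡⟨ ∏-cong (λ s → ∏-guard-≟ s λ s′ → sign (lt (M s′ r′) (M s r))) ⟨
    ∏ (λ s → ∏ λ s′ → guard ⌊ s ≟ s′ ⌋ (sign (lt (M s′ r′) (M s r))))
      ≡⟨ trans (∏-cong λ c → ∏-reindex (L r′) (row-inj lat r′) _) (∏-reindex (L r) (row-inj lat r) _) ⟨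
    ∏ (λ c → ∏ λ c′ → guard ⌊ L r c ≟ L r′ c′ ⌋ (sign (lt (M (L r′ c′) r′) (M (L r c) r))))
      ≡⟨ ∏-cong₂ (λ c c′ → cong₂ (λ x y → guard ⌊ L r c ≟ L r′ c′ ⌋ (sign (lt x y))) (ML r′ c′) (ML r c)) ⟩
    ∏ (λ c → ∏ λ c′ → guard ⌊ L r c ≟ L r′ c′ ⌋ (sign (lt c′ c))) ∎
    where
    ML : ∀ r c → M (L r c) r ≡ c
    ML r c = row-inj lat r (conj r (L r c))

  -- When neither comparison is a tie, the first two factors give -1 exactly if columns and symbols
  -- are ordered oppositely, and so do the last two. When one of them is a tie, the matching `guard`
  -- cancels the sign left by the other comparison.
  cancel : ∀ {c c′ u v : Fin n} {a e b a′ e′ b′} → Cmp c c′ a e b → Cmp u v a′ e′ b′ →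
    sign (a ∧ b′) * sign (b ∧ a′) * guard e (sign b′) * guard e′ (sign b) * sign b′ * sign b ≡ + 1
  cancel (less _) (less _) = refl
  cancel (less _) (same _) = refl
  cancel (less _) (more _) = refl
  cancel (same _) (less _) = refl
  cancel (same _) (same _) = refl
  cancel (same _) (more _) = refl
  cancel (more _) (less _) = refl
  cancel (more _) (same _) = refl
  cancel (more _) (more _) = refl

  rows : ∀ r r′ →
    F r r′ * F r′ r
    * ∏ (λ c → sign (lt (L r′ c) (L r c)))
    * ∏ (λ s → sign (lt (M s r′) (M s r)))
    * ∏ (λ c → ∏ λ c′ → sign (lt (L r′ c′) (L r c)))
    * ∏ (λ c → ∏ λ c′ → sign (lt c′ c)) ≡ + 1
  rows r r′ = begin
    F r r′ * F r′ r * ∏ (λ c → sign (lt (L r′ c) (L r c))) * ∏ (λ s → sign (lt (M s r′) (M s r))) * ∏∏ G₅ * ∏∏ G₆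
      ≡⟨ cong (λ x → x * ∏∏ G₅ * ∏∏ G₆) (cong₂ _*_ (cong₂ _*_ (cong (F r r′ *_) (∏-comm _)) (columns r r′)) (symbols r r′)) ⟩
    ∏∏ G₁ * ∏∏ G₂ * ∏∏ G₃ * ∏∏ G₄ * ∏∏ G₅ * ∏∏ G₆
      ≡⟨ cong (λ x → x * ∏∏ G₃ * ∏∏ G₄ * ∏∏ G₅ * ∏∏ G₆) (∏-distrib-*₂ G₁ G₂) ⟨
    ∏∏ G₁₂ * ∏∏ G₃ * ∏∏ G₄ * ∏∏ G₅ * ∏∏ G₆
      ≡⟨ cong (λ x → x * ∏∏ G₄ * ∏∏ G₅ * ∏∏ G₆) (∏-distrib-*₂ G₁₂ G₃) ⟨
    ∏∏ G₁₃ * ∏∏ G₄ * ∏∏ G₅ * ∏∏ G₆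
      ≡⟨ cong (λ x → x * ∏∏ G₅ * ∏∏ G₆) (∏-distrib-*₂ G₁₃ G₄) ⟨
    ∏∏ G₁₄ * ∏∏ G₅ * ∏∏ G₆
      ≡⟨ cong (λ x → x * ∏∏ G₆) (∏-distrib-*₂ G₁₄ G₅) ⟨
    ∏∏ G₁₅ * ∏∏ G₆
      ≡⟨ ∏-distrib-*₂ G₁₅ G₆ ⟨
    ∏∏ (λ c c′ → G₁₅ c c′ * G₆ c c′)
      ≡⟨ ∏-ones _ (λ c → ∏-ones _ λ c′ → cancel (cmp c c′) (cmp (L r c) (L r′ c′))) ⟩
    + 1 ∎
    where
    ∏∏ : (Fin n → Fin n → ℤ) → ℤ
    ∏∏ G = ∏ λ c → ∏ λ c′ → G c c′
    G₁ = λ c c′ → inversion c c′ (L r c) (L r′ c′)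
    G₂ = λ c c′ → inversion c′ c (L r′ c′) (L r c)
    G₃ = λ c c′ → guard ⌊ c ≟ c′ ⌋ (sign (lt (L r′ c′) (L r c)))
    G₄ = λ c c′ → guard ⌊ L r c ≟ L r′ c′ ⌋ (sign (lt c′ c))
    G₅ = λ c c′ → sign (lt (L r′ c′) (L r c))
    G₆ = λ (c c′ : Fin n) → sign (lt c′ c)
    G₁₂ = λ c c′ → G₁ c c′ * G₂ c c′
    G₁₃ = λ c c′ → G₁₂ c c′ * G₃ c c′
    G₁₄ = λ c c′ → G₁₃ c c′ * G₄ c c′
    G₁₅ = λ c c′ → G₁₄ c c′ * G₅ c c′

  QCS≡1 : Q * C * S ≡ + 1
  QCS≡1 = begin
    Q * C * S
      ≡⟨ trans (*-assoc (Q * C * S) W W) (trans (cong (Q * C * S *_) W²≡1) (*-identityʳ _)) ⟨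
    Q * C * S * W * W
      ≡⟨ cong₂ (λ x y → Q * C * S * x * y) W≡W₁ W≡W₂ ⟩
    Q * C * S * W₁ * W₂
      ≡⟨ cong₂ (λ x y → Q * x * y * W₁ * W₂) (signs (col L)) (signs (row M)) ⟩
    below B₁ * below B₂ * below B₃ * below B₄ * below B₅
      ≡⟨ cong (λ x → x * below B₃ * below B₄ * below B₅) (below-* B₁ B₂) ⟨
    below B₁₂ * below B₃ * below B₄ * below B₅
      ≡⟨ cong (λ x → x * below B₄ * below B₅) (below-* B₁₂ B₃) ⟨
    below B₁₃ * below B₄ * below B₅
      ≡⟨ cong (_* below B₅) (below-* B₁₃ B₄) ⟨
    below B₁₄ * below B₅
      ≡⟨ below-* B₁₄ B₅ ⟨
    below (λ r r′ → B₁₄ r r′ * B₅ r r′)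
      ≡⟨ ∏-ones _ (λ r → ∏-ones _ λ r′ → trans (guard-cong (lt r r′) λ _ → rows r r′) (guard-one (lt r r′))) ⟩
    + 1 ∎
    where
    B₁ = λ r r′ → F r r′ * F r′ r
    B₂ = λ r r′ → ∏ λ c → sign (lt (L r′ c) (L r c))
    B₃ = λ r r′ → ∏ λ s → sign (lt (M s r′) (M s r))
    B₄ = λ r r′ → ∏ λ c → ∏ λ c′ → sign (lt (L r′ c′) (L r c))
    B₅ = λ (r r′ : Fin n) → ∏ {n} λ c → ∏ {n} λ c′ → sign (lt c′ c)
    B₁₂ = λ r r′ → B₁ r r′ * B₂ r r′
    B₁₃ = λ r r′ → B₁₂ r r′ * B₃ r r′
    B₁₄ = λ r r′ → B₁₃ r r′ * B₄ r r′

-- The value of the crossing product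

triangular : ℕ → ℕ
triangular zero = 0
triangular (suc n) = n ℕ.+ triangular n

triangular-/ : ∀ n → (n ℕ.* (n ℕ.∸ 1)) ℕ./ 2 ≡ triangular n
triangular-/ n = trans (cong (ℕ._/ 2) (sym (double n))) (m*n/n≡m (triangular n) 2)
  where
  double : ∀ n → triangular n ℕ.* 2 ≡ n ℕ.* (n ℕ.∸ 1)
  double zero = refl
  double (suc zero) = refl
  double (suc n@(suc k)) = trans (ℕ.*-distribʳ-+ 2 n (triangular n))
    (trans (cong (n ℕ.* 2 ℕ.+_) (double n)) (ring k))
    where
    ring : ∀ k → suc k ℕ.* 2 ℕ.+ suc k ℕ.* k ≡ suc (suc k) ℕ.* suc k
    ring = ℕRing.solve-∀

neg1^-±1 : ∀ k → neg1^ k ≡ + 1 ⊎ neg1^ k ≡ - (+ 1)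
neg1^-±1 zero = inj₁ refl
neg1^-±1 (suc k) with neg1^-±1 k
... | inj₁ e = inj₂ (cong -_ e)
... | inj₂ e = inj₁ (cong -_ e)

-- One factor -1 per pair i < j; index zero accounts for n of them, matching the recursion of
-- `triangular`.
∏-sign-lt : ∀ n → ∏ {n} (λ i → ∏ {n} λ j → sign (lt i j)) ≡ neg1^ (triangular n)
∏-sign-lt zero = ∏-[] _
∏-sign-lt (suc n) = begin
  ∏ {suc n} (λ i → ∏ {suc n} λ j → sign (lt i j))
    ≡⟨ ∏-∷ _ ⟩
  ∏ {suc n} (λ j → sign (lt {suc n} zero j)) * ∏ {n} (λ i → ∏ {suc n} λ j → sign (lt (suc i) j))
    ≡⟨ cong₂ _*_ (trans (∏-∷ _) (trans (*-identityˡ _) (∏-const n (- (+ 1)))))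
         (∏-cong {n} λ i → trans (∏-∷ _) (*-identityˡ _)) ⟩
  (- (+ 1)) ^ n * ∏ {n} (λ i → ∏ {n} λ j → sign (lt i j))
    ≡⟨ cong₂ _*_ (neg1^-^ n) (∏-sign-lt n) ⟩
  neg1^ n * neg1^ (triangular n)
    ≡⟨ neg1^-+ n (triangular n) ⟨
  neg1^ (triangular (suc n)) ∎
  where
  open ≡-Reasoning
  neg1^-^ : ∀ k → (- (+ 1)) ^ k ≡ neg1^ k
  neg1^-^ zero = refl
  neg1^-^ (suc k) = trans (cong (- (+ 1) *_) (neg1^-^ k)) (-1*i≡-i (neg1^ k))

-- With t = `triangular n`, the inner product over columns is x = (-1)^t, and the pairs of rows
-- raise it to the power t. If x is 1 nothing changes; if x is -1 the outer product is `∏-sign-lt`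
-- once more. Either way the result is x.
crossings-value : ∀ n → crossings n ≡ neg1^ ((n ℕ.* (n ℕ.∸ 1)) ℕ./ 2)
crossings-value n rewrite triangular-/ n = begin
  crossings n
    ≡⟨ ∏-cong₂ (λ r r′ → trans (∏-cong₂ λ c c′ → inversion-guard r r′ c c′) (∏∏-guard r r′ _)) ⟩
  below (∏ {n} λ c → ∏ {n} λ c′ → sign (lt c′ c))
    ≡⟨ cong below (trans (∏-comm {n} {n} _) (∏-sign-lt n)) ⟩
  below (neg1^ (triangular n))
    ≡⟨ idem (neg1^-±1 (triangular n)) ⟩
  neg1^ (triangular n) ∎
  where
  open ≡-Reasoning
  below : ℤ → ℤ
  below x = ∏ {n} λ r → ∏ {n} λ r′ → guard (lt r r′) x
  idem : neg1^ (triangular n) ≡ + 1 ⊎ neg1^ (triangular n) ≡ - (+ 1) →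
    below (neg1^ (triangular n)) ≡ neg1^ (triangular n)
  idem (inj₁ e) = trans (cong below e) (trans (∏-ones _ λ r → ∏-ones _ λ r′ → guard-one (lt r r′)) (sym e))
  idem (inj₂ e) = trans (cong below e) (∏-sign-lt n)

-- Sums over lists

sum-cong : (xs : List A) {f g : A → ℤ} → f ≗ g → sumℤ xs f ≡ sumℤ xs g
sum-cong [] e = refl
sum-cong (x ∷ xs) e = cong₂ _+_ (e x) (sum-cong xs e)

sum-zero : (xs : List A) {f : A → ℤ} → (∀ x → f x ≡ + 0) → sumℤ xs f ≡ + 0
sum-zero [] e = refl
sum-zero (x ∷ xs) e = cong₂ _+_ (e x) (sum-zero xs e)

sum-distrib-+ : (xs : List A) (f g : A → ℤ) → sumℤ xs (λ x → f x + g x) ≡ sumℤ xs f + sumℤ xs g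
sum-distrib-+ [] f g = refl
sum-distrib-+ (x ∷ xs) f g = trans (cong (_+_ (f x + g x)) (sum-distrib-+ xs f g))
  (+-interchange (f x) (g x) (sumℤ xs f) (sumℤ xs g))
  where
  +-interchange : ∀ a b c d → (a + b) + (c + d) ≡ (a + c) + (b + d)
  +-interchange = solve-∀

*-distribˡ-sum : (xs : List A) (c : ℤ) (f : A → ℤ) → c * sumℤ xs f ≡ sumℤ xs (λ x → c * f x)
*-distribˡ-sum [] c f = *-zeroʳ c
*-distribˡ-sum (x ∷ xs) c f = trans (*-distribˡ-+ c (f x) (sumℤ xs f)) (cong (_+_ (c * f x)) (*-distribˡ-sum xs c f))

*-distribʳ-sum : (xs : List A) (c : ℤ) (f : A → ℤ) → sumℤ xs f * c ≡ sumℤ xs (λ x → f x * c)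
*-distribʳ-sum xs c f = trans (*-comm (sumℤ xs f) c)
  (trans (*-distribˡ-sum xs c f) (sum-cong xs λ x → *-comm c (f x)))

sum-comm : (xs : List A) (ys : List B) (f : A → B → ℤ) →
  sumℤ xs (λ x → sumℤ ys (f x)) ≡ sumℤ ys (λ y → sumℤ xs λ x → f x y)
sum-comm [] ys f = sym (sum-zero ys λ _ → refl)
sum-comm (x ∷ xs) ys f = trans (cong (_+_ (sumℤ ys (f x))) (sum-comm xs ys f)) (sym (sum-distrib-+ ys (f x) _))

sum-++ : (xs ys : List A) (f : A → ℤ) → sumℤ (xs ++ ys) f ≡ sumℤ xs f + sumℤ ys f
sum-++ [] ys f = sym (+-identityˡ _)
sum-++ (x ∷ xs) ys f = trans (cong (_+_ (f x)) (sum-++ xs ys f)) (sym (+-assoc (f x) _ _))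

sum-concatMap : (h : A → List B) (xs : List A) (f : B → ℤ) →
  sumℤ (concatMap h xs) f ≡ sumℤ xs (λ x → sumℤ (h x) f)
sum-concatMap h [] f = refl
sum-concatMap h (x ∷ xs) f = trans (sum-++ (h x) (concatMap h xs) f) (cong (_+_ (sumℤ (h x) f)) (sum-concatMap h xs f))

sum-map : (h : A → B) (xs : List A) (f : B → ℤ) → sumℤ (map h xs) f ≡ sumℤ xs (λ x → f (h x))
sum-map h [] f = refl
sum-map h (x ∷ xs) f = cong (_+_ (f (h x))) (sum-map h xs f)

sum-filter : (p : A → Bool) (xs : List A) (f : A → ℤ) →
  sumℤ (filter (λ x → T? (p x)) xs) f ≡ sumℤ xs (λ x → ι (p x) * f x)
sum-filter p [] f = refl
sum-filter p (x ∷ xs) f with p x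
... | true = cong₂ _+_ (sym (*-identityˡ (f x))) (sum-filter p xs f)
... | false = trans (sum-filter p xs f) (sym (trans (cong (_+ sumℤ xs (λ x → ι (p x) * f x)) (*-zeroˡ (f x))) (+-identityˡ (sumℤ xs λ x → ι (p x) * f x))))

-- The listed functions are case-splitting lambdas, equal to a given function only pointwise.
-- Restating `F` through head and tail as `G` replaces function extensionality.
sum-allFuns-suc : (xs : List A) (F : (Fin (suc m) → A) → ℤ) (G : A → (Fin m → A) → ℤ) →
  (∀ h → F h ≡ G (h zero) (λ i → h (suc i))) →
  sumℤ (allFuns (suc m) xs) F ≡ sumℤ xs (λ x → sumℤ (allFuns m xs) (G x))
sum-allFuns-suc {m = m} xs F G e = trans (sum-concatMap _ xs F) (sum-cong xs λ x →
  trans (sum-map _ (allFuns m xs) F) (sum-cong (allFuns m xs) λ f → e _))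

-- Generalised distributivity. Left to right it expands the permanent and the determinants into a
-- sum over squares; right to left it factors sums over matrices by rows and sums over rows by
-- entries.
∏-sum : (xs : List A) (g : Fin m → A → ℤ) →
  ∏ (λ k → sumℤ xs (g k)) ≡ sumℤ (allFuns m xs) (λ f → ∏ λ k → g k (f k))
∏-sum {m = zero} xs g = trans (∏-[] _) (sym (trans (+-identityʳ _) (∏-[] _)))
∏-sum {m = suc m} xs g = begin
  ∏ (λ k → sumℤ xs (g k))
    ≡⟨ ∏-∷ _ ⟩
  sumℤ xs (g zero) * ∏ (λ k → sumℤ xs (g (suc k)))
    ≡⟨ cong (sumℤ xs (g zero) *_) (∏-sum xs (g ∘ suc)) ⟩
  sumℤ xs (g zero) * sumℤ (allFuns m xs) H
    ≡⟨ *-distribʳ-sum xs _ (g zero) ⟩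
  sumℤ xs (λ x → g zero x * sumℤ (allFuns m xs) H)
    ≡⟨ sum-cong xs (λ x → *-distribˡ-sum (allFuns m xs) (g zero x) H) ⟩
  sumℤ xs (λ x → sumℤ (allFuns m xs) λ f → g zero x * H f)
    ≡⟨ sum-allFuns-suc xs _ (λ x f → g zero x * H f) (λ h → ∏-∷ (λ k → g k (h k))) ⟨
  sumℤ (allFuns (suc m) xs) (λ f → ∏ λ k → g k (f k)) ∎
  where
  open ≡-Reasoning
  H = λ f → ∏ λ k → g (suc k) (f k)

-- Finite enumerations up to a decidable relation

ι-yes : {P : Set} (d : Dec P) → P → ι ⌊ d ⌋ ≡ + 1
ι-yes (yes _) p = refl
ι-yes (no ¬p) p = contradiction p ¬p

ι-no : {P : Set} (d : Dec P) → ¬ P → ι ⌊ d ⌋ ≡ + 0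
ι-no (yes p) ¬p = contradiction p ¬p
ι-no (no _) ¬p = refl

ι-all? : {P : Fin n → Set} (d : ∀ i → Dec (P i)) → ι ⌊ all? d ⌋ ≡ ∏ (λ i → ι ⌊ d i ⌋)
ι-all? {n} {P} d with all? d
... | yes h = sym (∏-ones _ λ i → ι-yes (d i) (h i))
... | no ¬h with ¬∀⟶∃¬ n P d ¬h
...   | i , ¬p = sym (∏-zero _ i (ι-no (d i) ¬p))

-- A list meeting every class of `_≈_` exactly once. `once` is a sum of indicators so that it can be
-- inserted as a factor 1, and `_≈_` is pointwise agreement for functions.
record Enumeration (A : Set) : Set₁ where
  infix 4 _≈_ _≈?_
  field
    elements : List A
    _≈_ : A → A → Set
    _≈?_ : ∀ x y → Dec (x ≈ y)
    once : ∀ y → sumℤ elements (λ x → ι ⌊ x ≈? y ⌋) ≡ + 1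

sum-allFin-suc : (f : Fin (suc n) → ℤ) → sumℤ (allFin (suc n)) f ≡ f zero + sumℤ (allFin n) (f ∘ suc)
sum-allFin-suc {n} f = cong (_+_ (f zero)) (shift id)
  where
  shift : ∀ {k} (g : Fin k → Fin n) → sumℤ (tabulate (suc ∘ g)) f ≡ sumℤ (tabulate g) (f ∘ suc)
  shift {zero} g = refl
  shift {suc k} g = cong (_+_ (f (suc (g zero)))) (shift (g ∘ suc))

finEnum : ∀ n → Enumeration (Fin n)
finEnum n = record { elements = allFin n ; _≈_ = _≡_ ; _≈?_ = _≟_ ; once = once }
  where
  once : ∀ {n} (y : Fin n) → sumℤ (allFin n) (λ x → ι ⌊ x ≟ y ⌋) ≡ + 1
  once {suc n} zero = trans (sum-allFin-suc {n} λ x → ι ⌊ x ≟ zero ⌋) (cong (_+_ (+ 1)) (sum-zero (allFin n) λ _ → refl))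
  once {suc n} (suc y) = trans (sum-allFin-suc {n} λ x → ι ⌊ x ≟ suc y ⌋) (trans (+-identityˡ _)
    (trans (sum-cong (allFin n) λ x → cong ι (⌊suc≟suc⌋ x y)) (once y)))

funEnum : ∀ m → Enumeration A → Enumeration (Fin m → A)
funEnum m E = record
  { elements = allFuns m elements
  ; _≈_ = λ f g → ∀ i → f i ≈ g i
  ; _≈?_ = λ f g → all? λ i → f i ≈? g i
  ; once = λ g → trans (sum-cong (allFuns m elements) λ f → ι-all? λ i → f i ≈? g i)
      (trans (sym (∏-sum elements λ i x → ι ⌊ x ≈? g i ⌋)) (∏-ones _ λ i → once (g i)))
  }
  where open Enumeration E

module _ (E : Enumeration A) (E′ : Enumeration B) where
  open Enumeration E
  open Enumeration E′ renaming (elements to elements′; _≈_ to _≈′_; _≈?_ to _≈′?_; once to once′)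

  -- The factor 1, written as the sum over `b` of the indicator of `b ≈′ κ a`, is inserted at every
  -- `a`; then the sums are exchanged.
  sum-fibres : (κ : A → B) (F : A → ℤ) →
    sumℤ elements F ≡ sumℤ elements′ (λ b → sumℤ elements λ a → ι ⌊ b ≈′? κ a ⌋ * F a)
  sum-fibres κ F = begin
    sumℤ elements F
      ≡⟨ sum-cong elements (λ a → trans (cong (_* F a) (once′ (κ a))) (*-identityˡ (F a))) ⟨
    sumℤ elements (λ a → sumℤ elements′ (λ b → ι ⌊ b ≈′? κ a ⌋) * F a)
      ≡⟨ sum-cong elements (λ a → *-distribʳ-sum elements′ (F a) λ b → ι ⌊ b ≈′? κ a ⌋) ⟩
    sumℤ elements (λ a → sumℤ elements′ λ b → ι ⌊ b ≈′? κ a ⌋ * F a)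
      ≡⟨ sum-comm elements elements′ (λ a b → ι ⌊ b ≈′? κ a ⌋ * F a) ⟩
    sumℤ elements′ (λ b → sumℤ elements λ a → ι ⌊ b ≈′? κ a ⌋ * F a) ∎
    where open ≡-Reasoning

module _ (E : Enumeration A) (E′ : Enumeration B) where
  open Enumeration E
  open Enumeration E′ renaming (elements to elements′; _≈_ to _≈′_; _≈?_ to _≈′?_; once to once′)

  -- The graph of `φ` over `P` and the graph of `ψ` over `Q` consist of the same pairs, so two
  -- double sums agree term by term. The hypotheses concern related pairs `a`, `b` rather than `φ a`
  -- itself, because `P`, `Q`, `F` and `G` are not known to respect pointwise equality.
  sum-bijection : (P : A → Bool) (Q : B → Bool) (F : A → ℤ) (G : B → ℤ) (φ : A → B) (ψ : B → A) →
    (∀ a b → T (P a) → b ≈′ φ a → T (Q b) × a ≈ ψ b × F a ≡ G b) →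
    (∀ a b → T (Q b) → a ≈ ψ b → T (P a) × b ≈′ φ a) →
    sumℤ elements (λ a → ι (P a) * F a) ≡ sumℤ elements′ (λ b → ι (Q b) * G b)
  sum-bijection P Q F G φ ψ to from = begin
    sumℤ elements (λ a → ι (P a) * F a)
      ≡⟨ sum-fibres E E′ φ _ ⟩
    sumℤ elements′ (λ b → sumℤ elements λ a → ι ⌊ b ≈′? φ a ⌋ * (ι (P a) * F a))
      ≡⟨ sum-comm elements′ elements (λ b a → ι ⌊ b ≈′? φ a ⌋ * (ι (P a) * F a)) ⟩
    sumℤ elements (λ a → sumℤ elements′ λ b → ι ⌊ b ≈′? φ a ⌋ * (ι (P a) * F a))
      ≡⟨ sum-cong elements (λ a → sum-cong elements′ λ b → agree a b) ⟩
    sumℤ elements (λ a → sumℤ elements′ λ b → ι ⌊ a ≈? ψ b ⌋ * (ι (Q b) * G b))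
      ≡⟨ sum-fibres E′ E ψ _ ⟨
    sumℤ elements′ (λ b → ι (Q b) * G b) ∎
    where
    open ≡-Reasoning
    *0* : ∀ x y → x * (+ 0 * y) ≡ + 0
    *0* = solve-∀
    agree : ∀ a b → ι ⌊ b ≈′? φ a ⌋ * (ι (P a) * F a) ≡ ι ⌊ a ≈? ψ b ⌋ * (ι (Q b) * G b)
    agree a b with P a | Q b | b ≈′? φ a | a ≈? ψ b | to a b | from a b
    ... | true  | true  | yes p | yes q | t | f = cong (λ x → + 1 * (+ 1 * x)) (proj₂ (proj₂ (t tt p)))
    ... | true  | true  | no ¬p | yes q | t | f = contradiction (proj₂ (f tt q)) ¬p
    ... | true  | true  | yes p | no ¬q | t | f = contradiction (proj₁ (proj₂ (t tt p))) ¬q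
    ... | true  | true  | no ¬p | no ¬q | t | f = trans (*-zeroˡ (+ 1 * F a)) (sym (*-zeroˡ (+ 1 * G b)))
    ... | true  | false | yes p | q | t | f = ⊥-elim (proj₁ (t tt p))
    ... | true  | false | no ¬p | q | t | f = trans (*-zeroˡ (+ 1 * F a)) (sym (*0* (ι ⌊ q ⌋) (G b)))
    ... | false | true  | p | yes q | t | f = ⊥-elim (proj₁ (f tt q))
    ... | false | true  | p | no ¬q | t | f = trans (*0* (ι ⌊ p ⌋) (F a)) (sym (*-zeroˡ (+ 1 * G b)))
    ... | false | false | p | q | t | f = trans (*0* (ι ⌊ p ⌋) (F a)) (sym (*0* (ι ⌊ q ⌋) (G b)))

-- Counting permutations

notIn : Fin n → List (Fin n) → Bool
notIn x [] = true
notIn x (u ∷ us) = not ⌊ x ≟ u ⌋ ∧ notIn x us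

distinct : List (Fin n) → Bool
distinct [] = true
distinct (u ∷ us) = notIn u us ∧ distinct us

-- Injectivity in a form that recurses on the domain: the list accumulates the values already used,
-- so that arrangements can be counted one value at a time.
avoid : List (Fin n) → (Fin m → Fin n) → Bool
avoid {m = zero} us f = true
avoid {m = suc m} us f = notIn (f zero) us ∧ avoid (f zero ∷ us) (λ i → f (suc i))

sum-ones : ∀ n → sumℤ (allFin n) (λ _ → + 1) ≡ + n
sum-ones zero = refl
sum-ones (suc n) = trans (sum-allFin-suc {n} λ _ → + 1) (cong (_+_ (+ 1)) (sum-ones n))

-- Forbidding one more value `u` removes exactly one candidate. The indicator of `u` is added to
-- both sides and cancelled, which keeps subtraction out of the induction.
count-notIn : ∀ {n} (us : List (Fin n)) k → T (distinct us) → length us ℕ.+ k ≡ n →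
  sumℤ (allFin n) (λ x → ι (notIn x us)) ≡ + k
count-notIn {n} [] k d refl = sum-ones n
count-notIn {n} (u ∷ us) k d e = ∙-cancelʳ (AbelianGroup.group +-0-abelianGroup) (+ 1) _ _ (begin
  sumℤ xs (λ x → ι (notIn x (u ∷ us))) + + 1
    ≡⟨ cong (_+_ (sumℤ xs λ x → ι (notIn x (u ∷ us)))) (Enumeration.once (finEnum n) u) ⟨
  sumℤ xs (λ x → ι (notIn x (u ∷ us))) + sumℤ xs (λ x → ι ⌊ x ≟ u ⌋)
    ≡⟨ sum-distrib-+ xs (λ x → ι (notIn x (u ∷ us))) (λ x → ι ⌊ x ≟ u ⌋) ⟨
  sumℤ xs (λ x → ι (notIn x (u ∷ us)) + ι ⌊ x ≟ u ⌋)
    ≡⟨ sum-cong xs split ⟩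
  sumℤ xs (λ x → ι (notIn x us))
    ≡⟨ count-notIn us (suc k) (proj₂ (∧⁻ d)) (trans (ℕ.+-suc (length us) k) e) ⟩
  + suc k
    ≡⟨ cong +_ (ℕ.+-comm 1 k) ⟩
  + k + + 1 ∎)
  where
  open ≡-Reasoning
  xs = allFin n
  split : ∀ x → ι (notIn x (u ∷ us)) + ι ⌊ x ≟ u ⌋ ≡ ι (notIn x us)
  split x with x ≟ u
  ... | no _ = +-identityʳ _
  ... | yes refl = ι-⇔ {true} (λ _ → proj₁ (∧⁻ d)) (λ _ → tt)

count-avoid : ∀ {n} m (us : List (Fin n)) → T (distinct us) → length us ℕ.+ m ≡ n →
  sumℤ (allFuns m (allFin n)) (λ f → ι (avoid us f)) ≡ + (m !)
count-avoid zero us d e = refl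
count-avoid {n} (suc m) us d e = begin
  sumℤ (allFuns (suc m) xs) (λ f → ι (avoid us f))
    ≡⟨ sum-allFuns-suc xs _ (λ x f → ι (notIn x us) * ι (avoid (x ∷ us) f)) (λ h → ι-∧ (notIn (h zero) us) _) ⟩
  sumℤ xs (λ x → sumℤ (allFuns m xs) λ f → ι (notIn x us) * ι (avoid (x ∷ us) f))
    ≡⟨ sum-cong xs (λ x → *-distribˡ-sum (allFuns m xs) (ι (notIn x us)) λ f → ι (avoid (x ∷ us) f)) ⟨
  sumℤ xs (λ x → ι (notIn x us) * sumℤ (allFuns m xs) λ f → ι (avoid (x ∷ us) f))
    ≡⟨ sum-cong xs (λ x → ι-* (notIn x us) λ t →
         count-avoid m (x ∷ us) (∧⁺ t d) (trans (sym (ℕ.+-suc (length us) m)) e)) ⟩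
  sumℤ xs (λ x → ι (notIn x us) * + (m !))
    ≡⟨ *-distribʳ-sum xs (+ (m !)) (λ x → ι (notIn x us)) ⟨
  sumℤ xs (λ x → ι (notIn x us)) * + (m !)
    ≡⟨ cong (_* + (m !)) (count-notIn us (suc m) d e) ⟩
  + suc m * + (m !)
    ≡⟨ pos-* (suc m) (m !) ⟨
  + (suc m !) ∎
  where
  open ≡-Reasoning
  xs = allFin n

avoid⁻ : (us : List (Fin n)) (f : Fin m → Fin n) → T (avoid us f) → Inj f × (∀ k → T (notIn (f k) us))
avoid⁻ {m = zero} us f t = (λ { {()} }) , λ ()
avoid⁻ {m = suc m} us f t with ∧⁻ t
... | t₀ , t₁ with avoid⁻ (f zero ∷ us) (f ∘ suc) t₁
...   | inj , out = f-inj , λ { zero → t₀ ; (suc k) → proj₂ (∧⁻ (out k)) }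
  where
  f-inj : Inj f
  f-inj {zero} {zero} e = refl
  f-inj {zero} {suc j} e = contradiction (sym e) (not-≟⁻ (proj₁ (∧⁻ (out j))))
  f-inj {suc i} {zero} e = contradiction e (not-≟⁻ (proj₁ (∧⁻ (out i))))
  f-inj {suc i} {suc j} e = cong suc (inj e)

avoid⁺ : (us : List (Fin n)) (f : Fin m → Fin n) → Inj f → (∀ k → T (notIn (f k) us)) → T (avoid us f)
avoid⁺ {m = zero} us f inj out = tt
avoid⁺ {m = suc m} us f inj out = ∧⁺ (out zero) (avoid⁺ (f zero ∷ us) (f ∘ suc)
  (λ e → suc-injective (inj e)) λ k → ∧⁺ (not-≟⁺ (λ e → case inj e of λ ())) (out (suc k)))

count-perms : ∀ n → sumℤ (allFuns n (allFin n)) (λ f → ι (isPerm f)) ≡ + (n !)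
count-perms n = trans (sum-cong (allFuns n (allFin n)) λ f → ι-⇔
    (λ t → avoid⁺ [] f (isPerm⇒inj t) λ _ → tt)
    (λ t → inj⇒isPerm (proj₁ (avoid⁻ [] f t))))
  (count-avoid n [] tt refl)

-- The condition on the first column of a Latin square whose first row is the identity: the shared
-- corner entry forces it to fix `zero`.
fixing : (Fin (suc m) → Fin (suc m)) → Bool
fixing f = isPerm f ∧ ⌊ f zero ≟ zero ⌋

count-fixing : ∀ m → sumℤ (allFuns (suc m) (allFin (suc m))) (λ f → ι (fixing f)) ≡ + (m !)
count-fixing m = begin
  sumℤ (allFuns (suc m) xs) (λ f → ι (fixing f))
    ≡⟨ sum-allFuns-suc xs _ (λ x f → ι ⌊ x ≟ zero ⌋ * ι (avoid (zero ∷ []) f))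
         (λ h → trans (ι-⇔ {fixing h} {⌊ h zero ≟ zero ⌋ ∧ avoid (zero ∷ []) (h ∘ suc)} (to h) (from h)) (ι-∧ ⌊ h zero ≟ zero ⌋ _)) ⟩
  sumℤ xs (λ x → sumℤ (allFuns m xs) λ f → ι ⌊ x ≟ zero ⌋ * ι (avoid (zero ∷ []) f))
    ≡⟨ sum-cong xs (λ x → *-distribˡ-sum (allFuns m xs) (ι ⌊ x ≟ zero ⌋) λ f → ι (avoid (zero ∷ []) f)) ⟨
  sumℤ xs (λ x → ι ⌊ x ≟ zero ⌋ * sumℤ (allFuns m xs) λ f → ι (avoid (zero ∷ []) f))
    ≡⟨ *-distribʳ-sum xs _ (λ x → ι ⌊ x ≟ zero ⌋) ⟨
  sumℤ xs (λ x → ι ⌊ x ≟ zero ⌋) * sumℤ (allFuns m xs) (λ f → ι (avoid (zero ∷ []) f))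
    ≡⟨ cong₂ _*_ (Enumeration.once (finEnum (suc m)) zero) (count-avoid m (zero ∷ []) tt refl) ⟩
  + 1 * + (m !)
    ≡⟨ *-identityˡ _ ⟩
  + (m !) ∎
  where
  open ≡-Reasoning
  xs = allFin (suc m)
  to : ∀ h → T (fixing h) → T (⌊ h zero ≟ zero ⌋ ∧ avoid (zero ∷ []) (h ∘ suc))
  to h t with ∧⁻ {isPerm h} t
  ... | t₀ , t₁ = ∧⁺ t₁ (avoid⁺ (zero ∷ []) (h ∘ suc) (λ e → suc-injective (inj e))
      λ k → ∧⁺ (not-≟⁺ λ e → case inj (trans e (sym (toWitness t₁))) of λ ()) tt)
    where
    inj : Inj h
    inj = isPerm⇒inj t₀
  from : ∀ h → T (⌊ h zero ≟ zero ⌋ ∧ avoid (zero ∷ []) (h ∘ suc)) → T (fixing h)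
  from h t with ∧⁻ {⌊ h zero ≟ zero ⌋} t
  ... | t₀ , t₁ = ∧⁺ (inj⇒isPerm h-inj) t₀
    where
    h0 = toWitness t₀
    inj = proj₁ (avoid⁻ (zero ∷ []) (h ∘ suc) t₁)
    out = λ k → not-≟⁻ (proj₁ (∧⁻ (proj₂ (avoid⁻ (zero ∷ []) (h ∘ suc) t₁) k)))
    h-inj : Inj h
    h-inj {zero} {zero} e = refl
    h-inj {zero} {suc j} e = contradiction (trans (sym e) h0) (out j)
    h-inj {suc i} {zero} e = contradiction (trans e h0) (out i)
    h-inj {suc i} {suc j} e = cong suc (inj e)

-- The sum over (0,1)-matrices

-- Indicators are idempotent, so how often `f` hits `j` is immaterial; only whether it does matters.
-- The right side is a product over entries, to which `∏-sum` applies.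
guard-image : (f : Fin n → Fin n) (a : Fin n → Bool) →
  ∏ (λ k → ι (a (f k))) ≡ ∏ λ j → guard ⌊ any? (λ k → f k ≟ j) ⌋ (ι (a j))
guard-image {n} f a with all? (λ k → T? (a (f k)))
... | yes h = trans (∏-ones _ λ k → T⇒ι (h k)) (sym (∏-ones _ λ j → one j))
  where
  T⇒ι : ∀ {b} → T b → ι b ≡ + 1
  T⇒ι {true} _ = refl
  one : ∀ j → guard ⌊ any? (λ k → f k ≟ j) ⌋ (ι (a j)) ≡ + 1
  one j with any? (λ k → f k ≟ j)
  ... | yes (k , refl) = T⇒ι (h k)
  ... | no _ = refl
... | no ¬h with ¬∀⟶∃¬ n (λ k → T (a (f k))) (λ k → T? (a (f k))) ¬h
...   | k , ¬t = trans (∏-zero _ k (¬T⇒ι ¬t)) (sym (∏-zero _ (f k) zero-at))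
  where
  ¬T⇒ι : ∀ {b} → ¬ T b → ι b ≡ + 0
  ¬T⇒ι {true} ¬t = contradiction tt ¬t
  ¬T⇒ι {false} _ = refl
  zero-at : guard ⌊ any? (λ k′ → f k′ ≟ f k) ⌋ (ι (a (f k))) ≡ + 0
  zero-at with any? (λ k′ → f k′ ≟ f k)
  ... | yes _ = ¬T⇒ι ¬t
  ... | no ¬p = contradiction (k , refl) ¬p

bools : List Bool
bools = false ∷ true ∷ []

-- The alternating sum over a 0/1 row vanishes as soon as some entry is not tested by f.
alternating-row-sum : (f : Fin n → Fin n) →
  sumℤ (allFuns n bools) (λ a → ∏ (λ j → sign (not (a j))) * ∏ (λ k → ι (a (f k)))) ≡ ι (isPerm f)
alternating-row-sum {n} f = begin
  sumℤ rows (λ a → ∏ (λ j → sign (not (a j))) * ∏ (λ k → ι (a (f k))))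
    ≡⟨ sum-cong rows (λ a → trans (cong (∏ (λ j → sign (not (a j))) *_) (guard-image f a)) (sym (∏-distrib-* _ _))) ⟩
  sumℤ rows (λ a → ∏ λ j → sign (not (a j)) * guard (hit j) (ι (a j)))
    ≡⟨ ∏-sum bools (λ j b → sign (not b) * guard (hit j) (ι b)) ⟨
  ∏ (λ j → sumℤ bools λ b → sign (not b) * guard (hit j) (ι b))
    ≡⟨ ∏-cong (λ j → entry (hit j)) ⟩
  ∏ (λ j → ι (hit j))
    ≡⟨ ι-all? (λ j → any? λ k → f k ≟ j) ⟨
  ι ⌊ all? (λ j → any? λ k → f k ≟ j) ⌋
    ≡⟨ ι-⇔ (λ t → inj⇒isPerm (surj⇒inj f (toWitness t))) (λ t → fromWitness (inj⇒surj f (isPerm⇒inj t))) ⟩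
  ι (isPerm f) ∎
  where
  open ≡-Reasoning
  rows = allFuns n bools
  hit = λ j → ⌊ any? (λ k → f k ≟ j) ⌋
  -- A tested entry keeps only `true`, with sign +1; an untested one gives -1 + 1.
  entry : ∀ h → sumℤ bools (λ b → sign (not b) * guard h (ι b)) ≡ ι h
  entry true = refl
  entry false = refl

-- Row zero comes from the permanent and carries no sign.
tailSgn : Fin (suc m) → (Fin n → Fin n) → ℤ
tailSgn zero σ = + 1
tailSgn (suc k) σ = sgn σ

squares : ∀ n → List (Square n)
squares n = allFuns n (allFuns n (allFin n))

ι-isLatin : (L : Square n) → ι (isLatin L) ≡ ∏ (λ i → ι (isPerm (row L i))) * ∏ (λ j → ι (isPerm (col L j)))
ι-isLatin L = trans (ι-∧ (allB (allFin _) λ i → isPerm (row L i)) _) (cong₂ _*_ (ι-allB _) (ι-allB _))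

-- Row k of `L` is the permutation chosen in the k-th factor, so column i of `L` lists the entries
-- tested in row i of `A`. For fixed `L` the sum over `A` factors over the rows of `A`, and
-- `alternating-row-sum` makes each column of `L` a permutation; its rows are permutations already.
matrix-sum : ∀ m → let n = suc m in
  sumℤ (Bmats n) (λ A → neg1^ (σ₀ A) * per (toℤMatrix A) * (det (toℤMatrix A) ^ m))
  ≡ sumℤ (squares n) (λ L → ι (isLatin L) * ∏ λ k → tailSgn k (L k))
matrix-sum m = begin
  sumℤ (Bmats N) (λ A → neg1^ (σ₀ A) * per (toℤMatrix A) * (det (toℤMatrix A) ^ m))
    ≡⟨ sum-cong (Bmats N) (λ A → trans (*-assoc (neg1^ (σ₀ A)) _ _)
         (cong₂ _*_ (neg1^-∏∏ λ i j → not (A i j)) (expand A))) ⟩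
  sumℤ (Bmats N) (λ A → E A * sumℤ (squares N) λ L → P L * M A L)
    ≡⟨ sum-cong (Bmats N) (λ A → *-distribˡ-sum (squares N) (E A) λ L → P L * M A L) ⟩
  sumℤ (Bmats N) (λ A → sumℤ (squares N) λ L → E A * (P L * M A L))
    ≡⟨ sum-comm (Bmats N) (squares N) (λ A L → E A * (P L * M A L)) ⟩
  sumℤ (squares N) (λ L → sumℤ (Bmats N) λ A → E A * (P L * M A L))
    ≡⟨ sum-cong (squares N) collect ⟩
  sumℤ (squares N) (λ L → ι (isLatin L) * ∏ λ k → tailSgn k (L k)) ∎
  where
  open ≡-Reasoning
  N = suc m
  fns = allFuns N (allFin N)
  E : BoolMatrix N → ℤ
  E A = ∏ λ i → ∏ λ j → sign (not (A i j))
  M : BoolMatrix N → Square N → ℤ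
  M A L = ∏ λ k → ∏ λ i → ι (A i (L k i))
  R S P : Square N → ℤ
  R L = ∏ λ k → ι (isPerm (L k))
  S L = ∏ λ k → tailSgn k (L k)
  P L = R L * S L

  term : BoolMatrix N → Fin N → (Fin N → Fin N) → ℤ
  term A k σ = ι (isPerm σ) * tailSgn k σ * ∏ λ i → ι (A i (σ i))

  per-sum : ∀ A → per (toℤMatrix A) ≡ sumℤ fns (term A zero)
  per-sum A = trans (sum-filter isPerm fns _) (sum-cong fns λ σ →
    cong₂ _*_ (sym (*-identityʳ (ι (isPerm σ)))) (prodℤ-allFin _))

  det-sum : ∀ A (k : Fin m) → det (toℤMatrix A) ≡ sumℤ fns (term A (suc k))
  det-sum A k = trans (sum-filter isPerm fns _) (sum-cong fns λ σ →
    trans (cong (λ x → ι (isPerm σ) * (sgn σ * x)) (prodℤ-allFin _)) (sym (*-assoc (ι (isPerm σ)) (sgn σ) _)))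

  expand : ∀ A → per (toℤMatrix A) * (det (toℤMatrix A) ^ m) ≡ sumℤ (squares N) (λ L → P L * M A L)
  expand A = begin
    per (toℤMatrix A) * (det (toℤMatrix A) ^ m)
      ≡⟨ cong₂ _*_ (per-sum A) (trans (sym (∏-const m _)) (∏-cong (det-sum A))) ⟩
    sumℤ fns (term A zero) * ∏ (λ k → sumℤ fns (term A (suc k)))
      ≡⟨ ∏-∷ (λ k → sumℤ fns (term A k)) ⟨
    ∏ (λ k → sumℤ fns (term A k))
      ≡⟨ ∏-sum fns (term A) ⟩
    sumℤ (squares N) (λ L → ∏ λ k → term A k (L k))
      ≡⟨ sum-cong (squares N) (λ L → trans (∏-distrib-* _ _) (cong (_* M A L) (∏-distrib-* _ _))) ⟩
    sumℤ (squares N) (λ L → P L * M A L) ∎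

  weave : ∀ a r s b → a * (r * s * b) ≡ r * s * (a * b)
  weave = solve-∀

  swap-last : ∀ r s c → r * s * c ≡ r * c * s
  swap-last = solve-∀

  collect : ∀ L → sumℤ (Bmats N) (λ A → E A * (P L * M A L)) ≡ ι (isLatin L) * S L
  collect L = begin
    sumℤ (Bmats N) (λ A → E A * (P L * M A L))
      ≡⟨ sum-cong (Bmats N) (λ A → trans (weave (E A) (R L) (S L) (M A L))
           (cong (P L *_) (trans (cong (E A *_) (∏-comm _)) (sym (∏-distrib-* _ _))))) ⟩
    sumℤ (Bmats N) (λ A → P L * ∏ λ i → row-term i (A i))
      ≡⟨ *-distribˡ-sum (Bmats N) (P L) (λ A → ∏ λ i → row-term i (A i)) ⟨
    P L * sumℤ (Bmats N) (λ A → ∏ λ i → row-term i (A i))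
      ≡⟨ cong (P L *_) (∏-sum (allFuns N bools) row-term) ⟨
    P L * ∏ (λ i → sumℤ (allFuns N bools) (row-term i))
      ≡⟨ cong (P L *_) (∏-cong λ i → alternating-row-sum (col L i)) ⟩
    R L * S L * ∏ (λ i → ι (isPerm (col L i)))
      ≡⟨ swap-last (R L) (S L) _ ⟩
    R L * ∏ (λ i → ι (isPerm (col L i))) * S L
      ≡⟨ cong (_* S L) (ι-isLatin L) ⟨
    ι (isLatin L) * S L ∎
    where
    row-term : Fin N → (Fin N → Bool) → ℤ
    row-term i a = ∏ (λ j → sign (not (a j))) * ∏ (λ k → ι (a (L k i)))

-- Normalising Latin squares

isLatin⁻ : {L : Square n} → T (isLatin L) → Latin L
isLatin⁻ {L = L} t with ∧⁻ {allB (allFin _) λ i → isPerm (row L i)} t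
... | t₁ , t₂ = latin (λ r → isPerm⇒inj (allB⁻ t₁ r)) (λ c → isPerm⇒inj (allB⁻ t₂ c))

isLatin⁺ : {L : Square n} → Latin L → T (isLatin L)
isLatin⁺ lat = ∧⁺ (allB⁺ λ r → inj⇒isPerm (row-inj lat r)) (allB⁺ λ c → inj⇒isPerm (col-inj lat c))

Latin-resp : {L M : Square n} → (∀ i j → M i j ≡ L i j) → Latin L → Latin M
Latin-resp e lat = latin
  (λ r {c} {c′} q → row-inj lat r (trans (sym (e r c)) (trans q (e r c′))))
  (λ c {r} {r′} q → col-inj lat c (trans (sym (e r c)) (trans q (e r′ c))))

Latin-columns : {L : Square n} {τ : Fin n → Fin n} → Inj τ → Latin L → Latin (λ r c → L r (τ c))
Latin-columns {τ = τ} τ-inj lat = latin (λ r q → τ-inj (row-inj lat r q)) (λ c → col-inj lat (τ c))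

Latin-rows : {L : Square n} {τ : Fin n → Fin n} → Inj τ → Latin L → Latin (λ r c → L (τ r) c)
Latin-rows {τ = τ} τ-inj lat = latin (λ r → row-inj lat (τ r)) (λ c q → τ-inj (col-inj lat c q))

inv-inj : {f : Fin n → Fin n} → Inj f → Inj (inv f)
inv-inj {f = f} inj {x} {y} q = trans (sym (inv-right f inj x)) (trans (cong f q) (inv-right f inj y))

inv-unique : {f : Fin n → Fin n} → Inj f → ∀ {x y} → f x ≡ y → x ≡ inv f y
inv-unique {f = f} inj {x} {y} e = inj (trans e (sym (inv-right f inj y)))

funs : ∀ n → Enumeration (Fin n → Fin n)
funs n = funEnum n (finEnum n)

squareEnum : ∀ n → Enumeration (Square n)
squareEnum n = funEnum n (funs n)

module _ (E : Enumeration A) (E′ : Enumeration B) where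
  open Enumeration E
  open Enumeration E′ renaming (elements to elements′; _≈_ to _≈′_; _≈?_ to _≈′?_; once to once′)

  -- Grouping by the value of `κ`: fibres outside `C` are empty and all others have the same sum
  -- `x`.
  sum-equal-fibres : (κ : A → B) (P : A → Bool) (C : B → Bool) (F : A → ℤ) (x : ℤ) →
    (∀ a b → T (P a) → b ≈′ κ a → T (C b)) →
    (∀ b → T (C b) → sumℤ elements (λ a → ι (⌊ b ≈′? κ a ⌋ ∧ P a) * F a) ≡ x) →
    sumℤ elements (λ a → ι (P a) * F a) ≡ sumℤ elements′ (λ b → ι (C b)) * x
  sum-equal-fibres κ P C F x PC eq = begin
    sumℤ elements (λ a → ι (P a) * F a)
      ≡⟨ sum-fibres E E′ κ _ ⟩
    sumℤ elements′ (λ b → sumℤ elements λ a → ι ⌊ b ≈′? κ a ⌋ * (ι (P a) * F a))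
      ≡⟨ sum-cong elements′ (λ b → sum-cong elements λ a → trans (sym (*-assoc (ι ⌊ b ≈′? κ a ⌋) (ι (P a)) (F a)))
           (cong (_* F a) (sym (ι-∧ ⌊ b ≈′? κ a ⌋ (P a))))) ⟩
    sumℤ elements′ (λ b → sumℤ elements λ a → ι (⌊ b ≈′? κ a ⌋ ∧ P a) * F a)
      ≡⟨ sum-cong elements′ (λ b → ι-elim (C b) (eq b) λ ¬c → sum-zero elements λ a → empty b a ¬c) ⟩
    sumℤ elements′ (λ b → ι (C b) * x)
      ≡⟨ *-distribʳ-sum elements′ x (λ b → ι (C b)) ⟨
    sumℤ elements′ (λ b → ι (C b)) * x ∎
    where
    open ≡-Reasoning
    empty : ∀ b a → ¬ T (C b) → ι (⌊ b ≈′? κ a ⌋ ∧ P a) * F a ≡ + 0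
    empty b a ¬c with b ≈′? κ a | P a | PC a b
    ... | yes p | true  | c = contradiction (c tt p) ¬c
    ... | yes p | false | c = *-zeroˡ (F a)
    ... | no ¬p | _     | c = *-zeroˡ (F a)

-- Phrased as the test `b ≈′? κ a` of `sum-equal-fibres`, with `τ` as the value, so that fibres over
-- a prescribed first row take exactly this form. The same holds for `firstColumn`.
firstRow : (L : Square (suc m)) → (Fin (suc m) → Fin (suc m)) → Bool
firstRow {m} L τ = ⌊ Enumeration._≈?_ (funs (suc m)) τ (row L zero) ⌋

firstColumn : (L : Square (suc m)) → (Fin (suc m) → Fin (suc m)) → Bool
firstColumn {m} L τ = ⌊ Enumeration._≈?_ (funs (suc m)) τ (col L zero) ⌋

rowReduced : Square (suc m) → Bool
rowReduced L = firstRow L id ∧ isLatin L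

reduced : Square (suc m) → Bool
reduced L = firstColumn L id ∧ rowReduced L

firstRow⁺ : (L : Square (suc m)) (τ : Fin (suc m) → Fin (suc m)) →
  (∀ c → τ c ≡ L zero c) → Latin L → T (firstRow L τ ∧ isLatin L)
firstRow⁺ L τ e lat = ∧⁺ {firstRow L τ} {isLatin L} (fromWitness e) (isLatin⁺ lat)

firstRow⁻ : (L : Square (suc m)) (τ : Fin (suc m) → Fin (suc m)) →
  T (firstRow L τ ∧ isLatin L) → (∀ c → τ c ≡ L zero c) × Latin L
firstRow⁻ L τ t = Product.map toWitness isLatin⁻ (∧⁻ {firstRow L τ} {isLatin L} t)

firstColumn⁺ : (L : Square (suc m)) (τ : Fin (suc m) → Fin (suc m)) →
  (∀ r → τ r ≡ L r zero) → T (rowReduced L) → T (firstColumn L τ ∧ rowReduced L)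
firstColumn⁺ L τ e = ∧⁺ {firstColumn L τ} {rowReduced L} (fromWitness e)

firstColumn⁻ : (L : Square (suc m)) (τ : Fin (suc m) → Fin (suc m)) →
  T (firstColumn L τ ∧ rowReduced L) → (∀ r → τ r ≡ L r zero) × T (rowReduced L)
firstColumn⁻ L τ t = Product.map₁ toWitness (∧⁻ {firstColumn L τ} {rowReduced L} t)

tailSign : Square (suc m) → ℤ
tailSign L = ∏ λ k → tailSgn k (L k)

even-power : ∀ x k → x * x ≡ + 1 → x ^ (2 ℕ.* k) ≡ + 1
even-power x k e = trans (sym (^-*-assoc x 2 k)) (trans (cong (_^ k) (trans (cong (x *_) (*-identityʳ x)) e)) (^-zeroˡ k))

tailSign-columns : ∀ k {L M : Square (suc (2 ℕ.* k))} (τ : Fin (suc (2 ℕ.* k)) → Fin (suc (2 ℕ.* k))) →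
  Inj τ → Latin M → (∀ r c → L r c ≡ M r (τ c)) → tailSign L ≡ tailSign M
tailSign-columns k {L} {M} τ τ-inj lat e = begin
  tailSign L
    ≡⟨ ∏-∷ _ ⟩
  + 1 * ∏ (λ i → sgn (L (suc i)))
    ≡⟨ cong (+ 1 *_) (∏-cong λ i → trans (sgn-cong (e (suc i))) (sgn-∘ (M (suc i)) τ (row-inj lat (suc i)) τ-inj)) ⟩
  + 1 * ∏ (λ i → sgn (M (suc i)) * sgn τ)
    ≡⟨ cong (+ 1 *_) (∏-distrib-* _ _) ⟩
  + 1 * (∏ (λ i → sgn (M (suc i))) * ∏ {2 ℕ.* k} (λ _ → sgn τ))
    ≡⟨ cong (λ x → + 1 * (∏ (λ i → sgn (M (suc i))) * x))
         (trans (∏-const (2 ℕ.* k) (sgn τ)) (even-power (sgn τ) k (sgn-square τ))) ⟩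
  + 1 * (∏ (λ i → sgn (M (suc i))) * + 1)
    ≡⟨ cong (+ 1 *_) (*-identityʳ _) ⟩
  + 1 * ∏ (λ i → sgn (M (suc i)))
    ≡⟨ ∏-∷ (λ k → tailSgn k (M k)) ⟨
  tailSign M ∎
  where open ≡-Reasoning

-- Squares are grouped by their first row `τ`. Reading the columns through `inv τ` carries each
-- fibre to the row-reduced squares, so the n! fibres contribute equally.
normalise-row : ∀ k → let n = suc (2 ℕ.* k) in
  sumℤ (squares n) (λ L → ι (isLatin L) * tailSign L)
  ≡ + (n !) * sumℤ (squares n) (λ L → ι (rowReduced L) * tailSign L)
normalise-row k = trans
  (sum-equal-fibres squaresE (funs N) (λ L → row L zero) isLatin isPerm tailSign _
    (λ L τ t e → inj⇒isPerm λ {x} {y} q →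
      row-inj (isLatin⁻ t) zero (trans (sym (e x)) (trans q (e y))))
    (λ τ t → sum-bijection squaresE squaresE (λ L → firstRow L τ ∧ isLatin L) rowReduced tailSign tailSign
      (λ L r c → L r (inv τ c)) (λ L r c → L r (τ c)) (to τ (isPerm⇒inj t)) (from τ (isPerm⇒inj t))))
  (cong (_* sumℤ (squares N) (λ L → ι (rowReduced L) * tailSign L)) (count-perms N))
  where
  N = suc (2 ℕ.* k)
  squaresE = squareEnum N
  to : ∀ τ → Inj τ → ∀ L M → T (firstRow L τ ∧ isLatin L) → (∀ r c → M r c ≡ L r (inv τ c)) →
    T (rowReduced M) × (∀ r c → L r c ≡ M r (τ c)) × tailSign L ≡ tailSign M
  to τ τ-inj L M t e with firstRow⁻ L τ t
  ... | top , lat = firstRow⁺ M id (λ c → trans (sym (inv-right τ τ-inj c)) (trans (top (inv τ c)) (sym (e zero c)))) M-latin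
                  , back , tailSign-columns k τ τ-inj M-latin back
    where
    M-latin : Latin M
    M-latin = Latin-resp e (Latin-columns (inv-inj τ-inj) lat)
    back : ∀ r c → L r c ≡ M r (τ c)
    back r c = sym (trans (e r (τ c)) (cong (L r) (inv-left τ τ-inj c)))
  from : ∀ τ → Inj τ → ∀ L M → T (rowReduced M) → (∀ r c → L r c ≡ M r (τ c)) →
    T (firstRow L τ ∧ isLatin L) × (∀ r c → M r c ≡ L r (inv τ c))
  from τ τ-inj L M t e with firstRow⁻ M id t
  ... | top , lat = firstRow⁺ L τ (λ c → trans (top (τ c)) (sym (e zero c))) (Latin-resp e (Latin-columns τ-inj lat))
                  , λ r c → sym (trans (e r (inv τ c)) (cong (M r) (inv-right τ τ-inj c)))

-- The omitted first row is the identity, of sign 1. Including it makes the weight a product over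
-- all rows, which is invariant under permuting rows.
tailSign-rowReduced : {L : Square (suc m)} → T (rowReduced L) → tailSign L ≡ ∏ λ r → sgn (row L r)
tailSign-rowReduced {m} {L} t = trans (∏-∷ _) (trans
  (cong (_* ∏ (λ k → sgn (L (suc k)))) (sym (trans (sgn-cong (λ c → sym (proj₁ (firstRow⁻ L id t) c))) (sgn-id {suc m}))))
  (sym (∏-∷ λ k → sgn (L k))))

-- Squares are grouped by their first column `τ`, and the rows are permuted by `inv τ`. Since `τ`
-- fixes `zero`, the first row stays in place and remains the identity.
normalise-column : ∀ m → let n = suc m in
  sumℤ (squares n) (λ L → ι (rowReduced L) * tailSign L)
  ≡ + (m !) * sumℤ (squares n) (λ L → ι (reduced L) * tailSign L)
normalise-column m = trans
  (sum-equal-fibres squaresE (funs N) (λ L → col L zero) rowReduced fixing tailSign _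
    fixes
    (λ τ t → sum-bijection squaresE squaresE (λ L → firstColumn L τ ∧ rowReduced L) reduced tailSign tailSign
      (λ L r → L (inv τ r)) (λ L r → L (τ r)) (to τ t) (from τ t)))
  (cong (_* sumℤ (squares N) (λ L → ι (reduced L) * tailSign L)) (count-fixing m))
  where
  N = suc m
  squaresE = squareEnum N
  fixes : ∀ L τ → T (rowReduced L) → (∀ r → τ r ≡ L r zero) → T (fixing τ)
  fixes L τ t e with firstRow⁻ L id t
  ... | top , lat = ∧⁺ (inj⇒isPerm λ {x} {y} q → col-inj lat zero (trans (sym (e x)) (trans q (e y))))
                       (fromWitness (trans (e zero) (sym (top zero))))
  fixing-inj : ∀ {τ} → T (fixing τ) → Inj τ
  fixing-inj {τ} t = isPerm⇒inj (proj₁ (∧⁻ {isPerm τ} t))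
  fixing-zero : ∀ {τ} → T (fixing τ) → τ zero ≡ zero
  fixing-zero {τ} t = toWitness (proj₂ (∧⁻ {isPerm τ} t))
  to : ∀ τ → T (fixing τ) → ∀ L M → T (firstColumn L τ ∧ rowReduced L) → (∀ r c → M r c ≡ L (inv τ r) c) →
    T (reduced M) × (∀ r c → L r c ≡ M (τ r) c) × tailSign L ≡ tailSign M
  to τ t L M u e =
      firstColumn⁺ M id (λ r → trans (sym (inv-right τ τ-inj r)) (trans (left (inv τ r)) (sym (e r zero)))) M-reduced
    , back , signs
    where
    τ-inj = fixing-inj t
    left = proj₁ (firstColumn⁻ L τ u)
    L-reduced = proj₂ (firstColumn⁻ L τ u)
    top = proj₁ (firstRow⁻ L id L-reduced)
    back : ∀ r c → L r c ≡ M (τ r) c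
    back r c = sym (trans (e (τ r) c) (cong (λ x → L x c) (inv-left τ τ-inj r)))
    M-reduced : T (rowReduced M)
    M-reduced = firstRow⁺ M id (λ c → trans (top c) (trans (back zero c) (cong (λ x → M x c) (fixing-zero t))))
      (Latin-resp e (Latin-rows (inv-inj τ-inj) (proj₂ (firstRow⁻ L id L-reduced))))
    signs : tailSign L ≡ tailSign M
    signs = trans (tailSign-rowReduced L-reduced) (trans (∏-cong λ r → sgn-cong (back r))
      (trans (∏-reindex τ τ-inj λ r → sgn (M r)) (sym (tailSign-rowReduced M-reduced))))
  from : ∀ τ → T (fixing τ) → ∀ L M → T (reduced M) → (∀ r c → L r c ≡ M (τ r) c) →
    T (firstColumn L τ ∧ rowReduced L) × (∀ r c → M r c ≡ L (inv τ r) c)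
  from τ t L M u e =
      firstColumn⁺ L τ (λ r → trans (left (τ r)) (sym (e r zero)))
        (firstRow⁺ L id (λ c → trans (top c) (sym (trans (e zero c) (cong (λ x → M x c) (fixing-zero t)))))
          (Latin-resp e (Latin-rows τ-inj (proj₂ (firstRow⁻ M id M-reduced)))))
    , λ r c → sym (trans (e (inv τ r) c) (cong (λ x → M x c) (inv-right τ τ-inj r)))
    where
    τ-inj = fixing-inj t
    left = proj₁ (firstColumn⁻ M id u)
    M-reduced = proj₂ (firstColumn⁻ M id u)
    top = proj₁ (firstRow⁻ M id M-reduced)

-- The Alon–Tarsi number

±1-cases : ∀ x → ±1 x → x ≡ + 1 ⊎ x ≡ - (+ 1)
±1-cases x e = cases x (ℕ.m*n≡1⇒m≡1 ∣ x ∣ ∣ x ∣ (trans (sym (abs-* x x)) (cong ∣_∣ e)))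
  where
  cases : ∀ x → ∣ x ∣ ≡ 1 → x ≡ + 1 ⊎ x ≡ - (+ 1)
  cases (+ k) refl = inj₁ refl
  cases -[1+ k ] refl = inj₂ refl

sgnLS-±1 : (L : Square n) → ±1 (sgnLS L)
sgnLS-±1 L = trans (cong (λ x → x * x) (cong₂ _*_ (prodℤ-allFin _) (prodℤ-allFin _)))
  (trans (*-interchange R C R C) (cong₂ _*_ (±1-∏ λ r → sgn-square (row L r)) (±1-∏ λ c → sgn-square (col L c))))
  where
  R = ∏ λ r → sgn (row L r)
  C = ∏ λ c → sgn (col L c)

count-difference : (p : A → Bool) (xs : List A) →
  + countB xs p - + countB xs (λ x → not (p x)) ≡ sumℤ xs (λ x → sign (not (p x)))
count-difference p [] = refl
count-difference p (x ∷ xs) with p x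
... | true = trans (shift (+ countB xs p) (+ countB xs (λ x → not (p x)))) (cong (_+_ (+ 1)) (count-difference p xs))
  where
  shift : ∀ a b → (+ 1 + a) - b ≡ + 1 + (a - b)
  shift = solve-∀
... | false = trans (shift (+ countB xs p) (+ countB xs (λ x → not (p x)))) (cong (_+_ (- (+ 1))) (count-difference p xs))
  where
  shift : ∀ a b → a - (+ 1 + b) ≡ - (+ 1) + (a - b)
  shift = solve-∀

AT-sum : ∀ n → AT n ≡ sumℤ (squares n) (λ L → ι (isLatin L ∧ isNormalized L ∧ isUnipotent L) * sgnLS L)
AT-sum n = trans (count-difference isEven? (NULS n))
  (trans (sum-cong (NULS n) λ L → parity (sgnLS L) (±1-cases _ (sgnLS-±1 L)))
         (sum-filter (λ L → isLatin L ∧ isNormalized L ∧ isUnipotent L) (squares n) sgnLS))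
  where
  parity : ∀ x → x ≡ + 1 ⊎ x ≡ - (+ 1) → sign (not ⌊ x ℤ.≟ + 1 ⌋) ≡ x
  parity x (inj₁ refl) = refl
  parity x (inj₂ refl) = refl

normalized⁻ : (L : Square (suc m)) → T (isNormalized L) → ∀ c → L zero c ≡ c
normalized⁻ {m} L t c = toWitness (allB⁻ {p = λ c → ⌊ L zero c ≟ c ⌋} (allB⁻ {p = λ r → allB (allFin (suc m)) (entry r)} t zero) c)
  where
  entry : Fin (suc m) → Fin (suc m) → Bool
  entry r c = if toℕ r ℕ.≡ᵇ 0 then ⌊ L r c ≟ c ⌋ else true

normalized⁺ : (L : Square (suc m)) → (∀ c → L zero c ≡ c) → T (isNormalized L)
normalized⁺ {m} L h = allB⁺ λ r → allB⁺ (entry⁺ r)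
  where
  entry⁺ : ∀ r c → T (if toℕ r ℕ.≡ᵇ 0 then ⌊ L r c ≟ c ⌋ else true)
  entry⁺ zero c = fromWitness (h c)
  entry⁺ (suc r) c = tt

unipotent⁻ : (L : Square n) → T (isUnipotent L) → ∀ i j → L i i ≡ L j j
unipotent⁻ L t i j = toWitness (allB⁻ (allB⁻ t i) j)

unipotent⁺ : (L : Square n) → (∀ i j → L i i ≡ L j j) → T (isUnipotent L)
unipotent⁺ L h = allB⁺ λ i → allB⁺ λ j → fromWitness (h i j)

-- In the conjugate `M`, a first row of `L` equal to the identity becomes a first column equal to
-- the identity. The constant diagonal of `L` has value L 0 0 = 0, so symbol 0 sits in column r of
-- row r, and the first row of `M` is the identity. The weight transforms by `sgnLS-conjugate`.
AT-reduced : ∀ m → let n = suc m in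
  AT n ≡ crossings n * sumℤ (squares n) (λ L → ι (reduced L) * tailSign L)
AT-reduced m = begin
  AT N
    ≡⟨ AT-sum N ⟩
  sumℤ (squares N) (λ L → ι (nul L) * sgnLS L)
    ≡⟨ sum-bijection (squareEnum N) (squareEnum N) nul reduced sgnLS (λ M → crossings N * tailSign M)
         -- In the reverse direction, `L r c` is the symbol s with `M s r` equal to c, so column r
         -- of `M` is inverted.
         (λ L s r → inv (L r) s) (λ M r c → inv (col M r) c) to from ⟩
  sumℤ (squares N) (λ M → ι (reduced M) * (crossings N * tailSign M))
    ≡⟨ sum-cong (squares N) (λ M → swap (ι (reduced M)) (crossings N) (tailSign M)) ⟩
  sumℤ (squares N) (λ M → crossings N * (ι (reduced M) * tailSign M))
    ≡⟨ *-distribˡ-sum (squares N) (crossings N) (λ M → ι (reduced M) * tailSign M) ⟨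
  crossings N * sumℤ (squares N) (λ M → ι (reduced M) * tailSign M) ∎
  where
  open ≡-Reasoning
  N = suc m
  nul : Square N → Bool
  nul L = isLatin L ∧ isNormalized L ∧ isUnipotent L
  swap : ∀ x y z → x * (y * z) ≡ y * (x * z)
  swap = solve-∀
  to : ∀ L M → T (nul L) → (∀ s r → M s r ≡ inv (L r) s) →
    T (reduced M) × (∀ r c → L r c ≡ inv (col M r) c) × sgnLS L ≡ crossings N * tailSign M
  to L M t e =
      firstColumn⁺ M id (λ s → sym (trans (sym (norm (M s zero))) (conj zero s))) M-reduced
    , (λ r c → inv-unique (col-inj M-latin r) (row-inj lat r (conj r (L r c))))
    , trans (sgnLS-conjugate lat conj) (cong (crossings N *_) (sym (tailSign-rowReduced M-reduced)))
    where
    t₁ = ∧⁻ {isLatin L} t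
    t₂ = ∧⁻ {isNormalized L} (proj₂ t₁)
    lat : Latin L
    lat = isLatin⁻ (proj₁ t₁)
    norm : ∀ c → L zero c ≡ c
    norm = normalized⁻ L (proj₁ t₂)
    conj : Conjugate L M
    conj r s = trans (cong (L r) (e s r)) (inv-right (L r) (row-inj lat r) s)
    diagonal : ∀ r → L r r ≡ zero
    diagonal r = trans (unipotent⁻ L (proj₂ t₂) r zero) (norm zero)
    M-latin : Latin M
    M-latin = latin
      (λ s {r} {r′} q → col-inj lat (M s r) (trans (conj r s) (sym (trans (cong (L r′) q) (conj r′ s)))))
      (λ r {s} {s′} q → trans (sym (conj r s)) (trans (cong (L r) q) (conj r s′)))
    M-reduced : T (rowReduced M)
    M-reduced = firstRow⁺ M id (λ r → row-inj lat r (trans (diagonal r) (sym (conj r zero)))) M-latin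
  from : ∀ L M → T (reduced M) → (∀ r c → L r c ≡ inv (col M r) c) →
    T (nul L) × (∀ s r → M s r ≡ inv (L r) s)
  from L M t e =
      ∧⁺ (isLatin⁺ L-latin) (∧⁺ {isNormalized L} {isUnipotent L} (normalized⁺ L norm)
        (unipotent⁺ L λ i j → trans (diagonal i) (sym (diagonal j))))
    , λ s r → inv-unique (row-inj L-latin r) (col-inj lat r (conj r (M s r)))
    where
    left = proj₁ (firstColumn⁻ M id t)
    M-reduced = firstRow⁻ M id (proj₂ (firstColumn⁻ M id t))
    top = proj₁ M-reduced
    lat : Latin M
    lat = proj₂ M-reduced
    conj : ∀ r c → M (L r c) r ≡ c
    conj r c = trans (cong (λ s → M s r) (e r c)) (inv-right (col M r) (col-inj lat r) c)
    L-latin : Latin L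
    L-latin = latin
      (λ r {c} {c′} q → trans (sym (conj r c)) (trans (cong (λ s → M s r) q) (conj r c′)))
      (λ c {r} {r′} q → row-inj lat (L r c) (trans (conj r c) (sym (trans (cong (λ s → M s r′) q) (conj r′ c)))))
    norm : ∀ c → L zero c ≡ c
    norm c = trans (left (L zero c)) (conj zero c)
    diagonal : ∀ i → L i i ≡ zero
    diagonal i = col-inj lat i (trans (conj i i) (top i))

-- The denominator n! (n-1)! is cleared to the left, which keeps the identity in the integers. Both
-- sides reduce to `crossings n` times the two factorials times `reducedSum`.
theorem5 : (n : ℕ) → (∃ λ k → n ≡ 1 Data.Nat.+ 2 Data.Nat.* k) →
    + ((n !) Data.Nat.* ((n ∸ 1) !)) * AT n
    ≡ neg1^ ((n Data.Nat.* (n ∸ 1)) / 2)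
    * sumℤ (Bmats n) (λ A → neg1^ (σ₀ A) * per (toℤMatrix A) * (det (toℤMatrix A) ^ (n ∸ 1)))
theorem5 n (k , refl) = begin
  + ((n !) ℕ.* (m′ !)) * AT n
    ≡⟨ cong₂ _*_ (pos-* (n !) (m′ !)) (AT-reduced m′) ⟩
  + (n !) * + (m′ !) * (crossings n * reducedSum)
    ≡⟨ rearrange (+ (n !)) (+ (m′ !)) (crossings n) reducedSum ⟩
  crossings n * (+ (n !) * (+ (m′ !) * reducedSum))
    ≡⟨ cong₂ _*_ (crossings-value n) (sym (trans (matrix-sum m′)
         (trans (normalise-row k) (cong (+ (n !) *_) (normalise-column m′))))) ⟩
  neg1^ ((n ℕ.* m′) / 2)
    * sumℤ (Bmats n) (λ A → neg1^ (σ₀ A) * per (toℤMatrix A) * (det (toℤMatrix A) ^ m′)) ∎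
  where
  open ≡-Reasoning
  m′ = 2 ℕ.* k
  reducedSum = sumℤ (squares n) (λ L → ι (reduced L) * tailSign L)
  rearrange : ∀ a b c d → a * b * (c * d) ≡ c * (a * (b * d))
  rearrange = solve-∀
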